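{- Let $n$ and $m$ be integers with $3\leq m\leq \lfloor n/2\rfloor$, let $G$ be a bicyclic graph on $n$ vertices with matching number $m$, and let $D$ be any orientation of $G$. Then $$M_1(D)\leq \frac{1}{2}\left[m^2-m(1+2n)+n^2+5n+2\right],$$ with equality if and only if $D$ is isomorphic to $B^{(1)}_{n,m}$ or to $B^{(2)}_{n,m}$.
   Context: All graphs are finite and simple. A bicyclic graph is a connected graph with $|E|=|V|+1$. The matching number of a graph is the maximum number of pairwise disjoint edges. An orientation $D$ of a graph $G$ is obtained by replacing each edge $uv$ by exactly one of the arcs $uv$ (from $u$ to $v$) or $vu$. For a vertex $u$ of $D$, $d^+_u$ and $d^-_u$ denote its out-degree and in-degree. The first Zagreb index of a digraph $D=(V,A)$ is $M_1(D)=\frac{1}{2}\sum_{uv\in A}(d^+_u+d^-_v)$ (equivalently $\frac12\sum_{u\in V}[(d^+_u)^2+(d^-_u)^2]$). For $3\le m\le\lfloor n/2\rfloor$, $B_{n,m}$ is the bicyclic graph on $n$ vertices obtained from two triangles sharing exactly one common vertex $c$ (so $c$ has degree 4) by attaching $n-2m+1$ pendent edges and $m-3$ paths of length two at $c$; thus $c$ has degree $n-m+2$. The orientation $B^{(1)}_{n,m}$ of $B_{n,m}$: every edge incident with $c$ is oriented away from $c$; for each attached path $c\,a\,b$ of length two the edge $ab$ is oriented from $b$ to $a$; in each triangle $c\,x\,y$ the edge $xy$ is oriented in either direction (both choices give isomorphic digraphs). $B^{(2)}_{n,m}$ is obtained from $B^{(1)}_{n,m}$ by reversing every arc. -}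

module Defs where

open import Data.Nat using (ℕ; zero; suc; _+_; _*_; _∸_; _≤_; _<_; _≡ᵇ_; _<ᵇ_; _%_)
open import Data.Bool using (Bool; true; false; _∧_; _∨_; not; if_then_else_)
open import Data.Fin using (Fin; toℕ)
open import Data.List using (List; []; _∷_; length; map; concatMap; allFin)
open import Data.Nat.ListAction using (sum)
open import Data.List.Relation.Unary.All using (All)
open import Data.List.Relation.Unary.Unique.Propositional using (Unique)
open import Data.Product using (Σ; _×_; _,_; ∃)
open import Relation.Binary.PropositionalEquality using (_≡_)
open import Function.Definitions using (Bijective)

-- A (di)graph on the vertex set Fin n is given by a Bool-valued adjacency / arc relation.
Rel : ℕ → Set
Rel n = Fin n → Fin n → Bool

record SimpleGraph (n : ℕ) (G : Rel n) : Set where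
  field
    irrefl : ∀ u → G u u ≡ false
    sym    : ∀ u v → G u v ≡ G v u

data Walk {n : ℕ} (G : Rel n) : Fin n → Fin n → Set where
  here : ∀ {u} → Walk G u u
  step : ∀ {u w v} → G u w ≡ true → Walk G w v → Walk G u v

Connected : {n : ℕ} → Rel n → Set
Connected {n} G = ∀ (u v : Fin n) → Walk G u v

ind : Bool → ℕ
ind true = 1
ind false = 0

sumFin : (n : ℕ) → (Fin n → ℕ) → ℕ
sumFin n f = sum (map f (allFin n))

numEdges : {n : ℕ} → Rel n → ℕ
numEdges {n} G = sumFin n (λ u → sumFin n (λ v → ind ((toℕ u <ᵇ toℕ v) ∧ G u v)))

Bicyclic : (n : ℕ) → Rel n → Set
Bicyclic n G = Connected G × numEdges G ≡ n + 1

endpoints : {n : ℕ} → List (Fin n × Fin n) → List (Fin n)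
endpoints = concatMap (λ { (u , v) → u ∷ v ∷ [] })

IsMatching : {n : ℕ} → Rel n → List (Fin n × Fin n) → Set
IsMatching G M = All (λ { (u , v) → G u v ≡ true }) M × Unique (endpoints M)

MatchingNumber : {n : ℕ} → Rel n → ℕ → Set
MatchingNumber G m =
  (Σ _ λ M → IsMatching G M × length M ≡ m) ×
  (∀ M → IsMatching G M → length M ≤ m)

-- D (arc relation, A u v = true means arc u → v) is an orientation of G:
-- every edge gets at least one direction, and never both (so arcs ⊆ edges).
record IsOrientation (n : ℕ) (G D : Rel n) : Set where
  field
    cover : ∀ u v → G u v ≡ (D u v ∨ D v u)
    asym  : ∀ u v → D u v ≡ true → D v u ≡ false

outdeg indeg : {n : ℕ} → Rel n → Fin n → ℕ
outdeg {n} D u = sumFin n (λ v → ind (D u v))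
indeg  {n} D u = sumFin n (λ v → ind (D v u))

twiceM1 : {n : ℕ} → Rel n → ℕ
twiceM1 {n} D = sumFin n (λ u → outdeg D u * outdeg D u + indeg D u * indeg D u)

_≅_ : {n : ℕ} → Rel n → Rel n → Set
_≅_ {n} D E = Σ (Fin n → Fin n) λ f → Bijective _≡_ _≡_ f × (∀ u v → D u v ≡ E (f u) (f v))

-- B^{(1)}_{n,m} on labels 0..n-1:
--   0 = c; triangles c,1,2 and c,3,4 (arcs c→1,c→2,c→3,c→4, 1→2, 3→4);
--   pendent vertices 5 .. P-1 where P = 5 + (n - 2m + 1), arcs c→v;
--   paths c a_j b_j with a_j = P + 2j, b_j = P + 2j + 1 (j = 0..m-4), arcs c→a_j, b_j→a_j.
-- Vertex count: 5 + (n-2m+1) + 2(m-3) = n.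
B1arc : ℕ → ℕ → ℕ → ℕ → Bool
B1arc n m u v =
     ((u ≡ᵇ 0) ∧ (0 <ᵇ v) ∧ (v <ᵇ P))
  ∨ ((u ≡ᵇ 0) ∧ not (v <ᵇ P) ∧ (v <ᵇ n) ∧ (((v ∸ P) % 2) ≡ᵇ 0))
  ∨ ((u ≡ᵇ 1) ∧ (v ≡ᵇ 2))
  ∨ ((u ≡ᵇ 3) ∧ (v ≡ᵇ 4))
  ∨ (not (u <ᵇ P) ∧ (u <ᵇ n) ∧ (((u ∸ P) % 2) ≡ᵇ 1) ∧ ((v + 1) ≡ᵇ u))
  where
  P : ℕ
  P = 5 + ((n ∸ 2 * m) + 1)

B1 : (n m : ℕ) → Rel n
B1 n m u v = B1arc n m (toℕ u) (toℕ v)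

B2 : (n m : ℕ) → Rel n
B2 n m u v = B1 n m v u

{-# OPTIONS --safe #-}

-- Regard every arc as an edge between the tail copy and the head copy of the vertex set. Then 2 M₁(D) is
-- the sum of the squared degrees of a bipartite graph with n + 1 edges that contains a matching M of size m;
-- equivalently, it is the sum over all ordered pairs of edges of the number of ends they share. An edge e
-- outside M whose ends have degree sum at most k + 2, with k the number of edges outside M, can be deleted
-- without losing the bound. If there is no such edge, the edges outside M pairwise intersect, so they form
-- a star, and M covers all its vertices, so k < m and the bound is immediate. In the case of equality every
-- degree sum is at least k + 2; two disjoint edges outside M would then span a 4-cycle outside M covered by
-- four edges of M, which contradicts k > m. So the edges outside M form a star, whose centre and m - 1 of
-- whose leaves are covered by M. Counting vertices, exactly two of the remaining m - 1 arcs of M close a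
-- triangle with the centre, which is B⁽¹⁾ or, if the centre is a head, its reversal B⁽²⁾.
module Submission where

open import Defs
open import Data.Bool using (Bool; true; false; T; not; _∧_; _∨_; if_then_else_)
open import Data.Bool.Properties using (T?; T-≡; T-∧; T-∨; ∨-comm)
open import Data.Empty using (⊥; ⊥-elim)
open import Data.Fin using (Fin; toℕ; fromℕ<)
open import Data.Fin.Properties as Finₚ using (toℕ-injective; toℕ-fromℕ<; toℕ<n)
open import Data.List using (List; []; _∷_; _++_; length; map; filter; cartesianProduct; allFin; applyUpTo)
open import Data.List.Properties using (map-++; map-∘; length-map; length-++; length-applyUpTo; length-tabulate; ++-assoc)
open import Data.List.Membership.Propositional using (_∈_; _∉_; find; lose)
open import Data.List.Membership.Propositional.Properties
open import Data.List.Relation.Binary.Permutation.Propositional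
  using (_↭_; prep; ↭⇒↭ₛ; ↭-refl; ↭-trans; ↭-sym; ↭-reflexive; module PermutationReasoning)
open import Data.List.Relation.Binary.Permutation.Propositional.Properties as Permₚ using (shift; ∈-resp-↭; ↭-length)
import Data.List.Relation.Binary.Permutation.Setoid.Properties as Permₛ
open import Data.List.Relation.Unary.All as All using ([]; _∷_)
open import Data.List.Relation.Unary.All.Properties using (¬Any⇒All¬)
open import Data.List.Relation.Unary.AllPairs using ([]; _∷_)
open import Data.List.Relation.Unary.Any using (here; there; any?)
open import Data.List.Relation.Unary.Unique.Propositional using (Unique)
open import Data.List.Relation.Unary.Unique.Propositional.Properties as Uniqueₚ using (Unique[x∷xs]⇒x∉xs)
open import Data.Nat using (ℕ; zero; suc; _+_; _*_; _∸_; _/_; _%_; _≤_; _<_; _<ᵇ_; _≡ᵇ_; _≤?_; z≤n; s≤s)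
open import Data.Nat.DivMod using (m≡m%n+[m/n]*n; m*n%n≡0; [m+kn]%n≡m%n; m/n*n≤m)
open import Data.Nat.ListAction using (sum)
open import Data.Nat.ListAction.Properties using (sum-++; sum-↭)
open import Data.Nat.Properties as ℕₚ hiding (_≟_)
open import Data.Nat.Tactic.RingSolver using (solve-∀)
open import Data.Product using (∃; _×_; _,_; proj₁; proj₂; swap)
open import Data.Product.Properties using (≡-dec)
open import Data.Sum using (_⊎_; inj₁; inj₂)
open import Function.Bundles using (Equivalence; _⇔_; mk⇔)
open import Level using (0ℓ)
open import Relation.Binary.Definitions using (DecidableEquality; tri<; tri≈; tri>)
open import Relation.Binary.PropositionalEquality hiding ([_])
open import Relation.Nullary using (¬_; ¬?; yes; no; does; decidable-stable)
open import Relation.Unary using (Pred; Decidable)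

cancel-≤ : ∀ c {a b x y} → x ≤ y → a + c ≡ x → b + c ≡ y → a ≤ b
cancel-≤ c x≤y refl refl = +-cancelʳ-≤ c _ _ x≤y

-- Duplicate-free lists up to permutation

module _ {A : Set} where

  ∈⇒↭ : ∀ {x : A} {xs} → x ∈ xs → ∃ λ ys → xs ↭ x ∷ ys
  ∈⇒↭ x∈ with ys , zs , refl ← ∈-∃++ x∈ = ys ++ zs , shift _ ys zs

  Unique-resp-↭ : ∀ {xs ys : List A} → xs ↭ ys → Unique xs → Unique ys
  Unique-resp-↭ p = Permₛ.Unique-resp-↭ (setoid A) (↭⇒↭ₛ p)

  Unique-∷ : ∀ {x : A} {xs} → x ∉ xs → Unique xs → Unique (x ∷ xs)
  Unique-∷ x∉ u = ¬Any⇒All¬ _ x∉ ∷ u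

  ∈-∷-≢ : ∀ {x y : A} {xs} → x ∈ y ∷ xs → x ≢ y → x ∈ xs
  ∈-∷-≢ (here eq) ne = ⊥-elim (ne eq)
  ∈-∷-≢ (there m) _  = m

  Unique-⊆-complement : ∀ {xs ys : List A} → Unique xs → (∀ {x} → x ∈ xs → x ∈ ys) →
                        ∃ λ zs → ys ↭ xs ++ zs
  Unique-⊆-complement {[]} _ _ = _ , ↭-refl
  Unique-⊆-complement {x ∷ xs} ux@(_ ∷ u) sub with ys , p ← ∈⇒↭ (sub (here refl))
    with zs , q ← Unique-⊆-complement u (λ z∈ → ∈-∷-≢ (∈-resp-↭ p (sub (there z∈)))
                   (λ { refl → Unique[x∷xs]⇒x∉xs ux z∈ }))
    = zs , ↭-trans p (prep x q)

  Unique-⊆-length : ∀ {xs ys : List A} → Unique xs → (∀ {x} → x ∈ xs → x ∈ ys) → length xs ≤ length ys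
  Unique-⊆-length {xs} u sub with zs , p ← Unique-⊆-complement u sub
    = ≤-trans (m≤m+n (length xs) (length zs))
        (≤-reflexive (trans (sym (length-++ xs)) (sym (↭-length p))))

  Unique-⊆-full : DecidableEquality A → ∀ {xs ys : List A} → Unique xs → (∀ {x} → x ∈ xs → x ∈ ys) →
                  length ys ≤ length xs → ∀ {y} → y ∈ ys → y ∈ xs
  Unique-⊆-full _≟_ {xs} u sub len {y} y∈ with y ∈? xs
    where open import Data.List.Membership.DecPropositional _≟_ using (_∈?_)
  ... | yes p = p
  ... | no y∉ = ⊥-elim (<⇒≱ (Unique-⊆-length (Unique-∷ y∉ u) sub′) len)
    where
    sub′ : ∀ {x} → x ∈ y ∷ xs → x ∈ _
    sub′ (here refl) = y∈
    sub′ (there x∈)  = sub x∈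

-- Finite sums over lists

∑ : ∀ {A : Set} → List A → (A → ℕ) → ℕ
∑ xs f = sum (map f xs)

module _ {A : Set} where

  ∑-++ : ∀ (xs ys : List A) f → ∑ (xs ++ ys) f ≡ ∑ xs f + ∑ ys f
  ∑-++ xs ys f rewrite map-++ f xs ys = sum-++ (map f xs) (map f ys)

  ∑-↭ : ∀ {xs ys : List A} f → xs ↭ ys → ∑ xs f ≡ ∑ ys f
  ∑-↭ f p = sum-↭ (Permₚ.map⁺ f p)

  ∑-map : ∀ {B : Set} (g : B → A) xs f → ∑ (map g xs) f ≡ ∑ xs (λ x → f (g x))
  ∑-map g xs f = cong sum (sym (map-∘ xs))

  ∑-cong : ∀ {f g : A → ℕ} xs → (∀ x → f x ≡ g x) → ∑ xs f ≡ ∑ xs g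
  ∑-cong []       h = refl
  ∑-cong (x ∷ xs) h = cong₂ _+_ (h x) (∑-cong xs h)

  ∑-cong-∈ : ∀ {f g : A → ℕ} xs → (∀ {x} → x ∈ xs → f x ≡ g x) → ∑ xs f ≡ ∑ xs g
  ∑-cong-∈ []       h = refl
  ∑-cong-∈ (x ∷ xs) h = cong₂ _+_ (h (here refl)) (∑-cong-∈ xs (λ x∈ → h (there x∈)))

  ∑-+ : ∀ (xs : List A) f g → ∑ xs (λ x → f x + g x) ≡ ∑ xs f + ∑ xs g
  ∑-+ []       f g = refl
  ∑-+ (x ∷ xs) f g rewrite ∑-+ xs f g = interchange (f x) (g x) (∑ xs f) (∑ xs g)
    where
    interchange : ∀ a b c d → a + b + (c + d) ≡ a + c + (b + d)
    interchange = solve-∀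

  ∑-*ˡ : ∀ c (xs : List A) f → ∑ xs (λ x → c * f x) ≡ c * ∑ xs f
  ∑-*ˡ c []       f = sym (*-zeroʳ c)
  ∑-*ˡ c (x ∷ xs) f rewrite ∑-*ˡ c xs f = sym (*-distribˡ-+ c (f x) (∑ xs f))

  ∑-zero : ∀ (xs : List A) → ∑ xs (λ _ → 0) ≡ 0
  ∑-zero []       = refl
  ∑-zero (x ∷ xs) = ∑-zero xs

  ∑-mono : ∀ {f g : A → ℕ} xs → (∀ {x} → x ∈ xs → f x ≤ g x) → ∑ xs f ≤ ∑ xs g
  ∑-mono []       h = z≤n
  ∑-mono (x ∷ xs) h = +-mono-≤ (h (here refl)) (∑-mono xs (λ x∈ → h (there x∈)))

  ∑-const : ∀ c (xs : List A) → ∑ xs (λ _ → c) ≡ length xs * c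
  ∑-const c []       = refl
  ∑-const c (_ ∷ xs) = cong (c +_) (∑-const c xs)

  ∑-≤const : ∀ {f : A → ℕ} xs c → (∀ {x} → x ∈ xs → f x ≤ c) → ∑ xs f ≤ length xs * c
  ∑-≤const xs c h = ≤-trans (∑-mono xs h) (≤-reflexive (∑-const c xs))

  ∑-≥const : ∀ {f : A → ℕ} xs c → (∀ {x} → x ∈ xs → c ≤ f x) → length xs * c ≤ ∑ xs f
  ∑-≥const xs c h = ≤-trans (≤-reflexive (sym (∑-const c xs))) (∑-mono xs h)

  ∈⇒≤∑ : ∀ {f : A → ℕ} {xs x} → x ∈ xs → f x ≤ ∑ xs f
  ∈⇒≤∑ {f} (here {xs = xs} refl) = m≤m+n (f _) (∑ xs f)
  ∈⇒≤∑ {f} (there {x = y} x∈) = ≤-trans (∈⇒≤∑ x∈) (m≤n+m _ (f y))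

  -- There is no slack: if all terms but one are replaced by their upper bound 1, at least 1 must
  -- remain for that one.
  ∑-tight : ∀ {f : A → ℕ} xs → (∀ {x} → x ∈ xs → f x ≤ 1) → length xs ≤ ∑ xs f →
            ∀ {x} → x ∈ xs → 1 ≤ f x
  ∑-tight {f} (y ∷ xs) h len (here refl) =
    +-cancelʳ-≤ (length xs) 1 (f y) (≤-trans len (+-monoʳ-≤ (f y)
      (≤-trans (∑-≤const xs 1 (λ x∈ → h (there x∈))) (≤-reflexive (*-identityʳ (length xs))))))
  ∑-tight {f} (y ∷ xs) h len (there x∈) =
    ∑-tight xs (λ x∈ → h (there x∈)) (+-cancelˡ-≤ 1 _ _ (≤-trans len (+-monoˡ-≤ (∑ xs f) (h (here refl))))) x∈

∑-swap : ∀ {A B : Set} (xs : List A) (ys : List B) (f : A → B → ℕ) →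
         ∑ xs (λ x → ∑ ys (f x)) ≡ ∑ ys (λ y → ∑ xs (λ x → f x y))
∑-swap []       ys f = sym (∑-zero ys)
∑-swap (x ∷ xs) ys f rewrite ∑-swap xs ys f = sym (∑-+ ys (f x) (λ y → ∑ xs (λ x → f x y)))

-- Shared ends, degrees and energy of arc lists

module Incidence {A : Set} (_≟_ : DecidableEquality A) where

  Arc : Set
  Arc = A × A

  δ : A → A → ℕ
  δ x y = ind (does (x ≟ y))

  δ≤1 : ∀ x y → δ x y ≤ 1
  δ≤1 x y with x ≟ y
  ... | yes _ = ≤-refl
  ... | no  _ = z≤n

  δ-refl : ∀ x → δ x x ≡ 1
  δ-refl x with x ≟ x
  ... | yes _ = refl
  ... | no ne = ⊥-elim (ne refl)

  δ-≢ : ∀ {x y} → x ≢ y → δ x y ≡ 0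
  δ-≢ {x} {y} ne with x ≟ y
  ... | yes e = ⊥-elim (ne e)
  ... | no  _ = refl

  δ-sym : ∀ x y → δ x y ≡ δ y x
  δ-sym x y with x ≟ y
  ... | yes refl = sym (δ-refl x)
  ... | no ne    = sym (δ-≢ (λ e → ne (sym e)))

  ∑δ≤1 : ∀ {xs} x → Unique xs → ∑ xs (δ x) ≤ 1
  ∑δ≤1 {[]} x _ = z≤n
  ∑δ≤1 {y ∷ xs} x u@(_ ∷ us) with x ≟ y
  ... | no  _    = ∑δ≤1 x us
  ... | yes refl = s≤s (≤-trans (∑-≤const xs 0 (λ z∈ → ≤-reflexive (δ-≢ (λ { refl → Unique[x∷xs]⇒x∉xs u z∈ }))))
                      (≤-reflexive (*-zeroʳ (length xs))))

  ∑δ≥1 : ∀ {xs x} → x ∈ xs → 1 ≤ ∑ xs (δ x)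
  ∑δ≥1 {xs} {x} x∈ = ≤-trans (≤-reflexive (sym (δ-refl x))) (∈⇒≤∑ {f = δ x} x∈)

  ∑δ≥1⇒∈ : ∀ {xs x} → 1 ≤ ∑ xs (δ x) → x ∈ xs
  ∑δ≥1⇒∈ {y ∷ xs} {x} h with x ≟ y
  ... | yes e = here e
  ... | no  _ = there (∑δ≥1⇒∈ h)

  ∑δ-∉ : ∀ {xs x} → x ∉ xs → ∑ xs (δ x) ≡ 0
  ∑δ-∉ {xs} {x} x∉ with ∑ xs (δ x) in eq
  ... | zero  = refl
  ... | suc _ = ⊥-elim (x∉ (∑δ≥1⇒∈ {xs} (subst (1 ≤_) (sym eq) (s≤s z≤n))))

  -- Tails are compared only with tails and heads only with heads, because the tail copy and the
  -- head copy of a vertex are different vertices of the bipartite graph.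
  share : Arc → Arc → ℕ
  share e f = δ (proj₁ e) (proj₁ f) + δ (proj₂ e) (proj₂ f)

  share-sym : ∀ e f → share e f ≡ share f e
  share-sym e f = cong₂ _+_ (δ-sym _ _) (δ-sym _ _)

  share-refl : ∀ e → share e e ≡ 2
  share-refl e = cong₂ _+_ (δ-refl (proj₁ e)) (δ-refl (proj₂ e))

  share≤2 : ∀ e f → share e f ≤ 2
  share≤2 e f = +-mono-≤ (δ≤1 (proj₁ e) (proj₁ f)) (δ≤1 (proj₂ e) (proj₂ f))

  share-≢ : ∀ {e f} → e ≢ f → share e f ≤ 1
  share-≢ {a , b} {c , d} ne with a ≟ c | b ≟ d
  ... | yes refl | yes refl = ⊥-elim (ne refl)
  ... | yes _    | no _     = ≤-refl
  ... | no _     | yes _    = ≤-refl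
  ... | no _     | no _     = z≤n

  share≥1 : ∀ {e f} → 1 ≤ share e f → (proj₁ e ≡ proj₁ f) ⊎ (proj₂ e ≡ proj₂ f)
  share≥1 {a , b} {c , d} h with a ≟ c | b ≟ d
  ... | yes p | _     = inj₁ p
  ... | no _  | yes p = inj₂ p

  share≡0 : ∀ {e f} → share e f ≡ 0 → (proj₁ e ≢ proj₁ f) × (proj₂ e ≢ proj₂ f)
  share≡0 {a , b} {c , d} h with a ≟ c | b ≟ d
  ... | no p | no q = p , q

  -- The degree sum of the two ends of `e` in the bipartite graph with edge list `L`; an arc that
  -- belongs to `L` counts itself twice.
  deg : List Arc → Arc → ℕ
  deg L e = ∑ L (share e)

  -- Grouping the ordered pairs of arcs by the end they share shows that this is the sum of the
  -- squared degrees in the bipartite graph.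
  energy : List Arc → ℕ
  energy L = ∑ L (deg L)

  deg-++ : ∀ L K e → deg (L ++ K) e ≡ deg L e + deg K e
  deg-++ L K e = ∑-++ L K (share e)

  deg-split : ∀ L e → deg L e ≡ ∑ (map proj₁ L) (δ (proj₁ e)) + ∑ (map proj₂ L) (δ (proj₂ e))
  deg-split L e rewrite ∑-map proj₁ L (δ (proj₁ e)) | ∑-map proj₂ L (δ (proj₂ e)) = ∑-+ L _ _

  energy-↭ : ∀ {L K} → L ↭ K → energy L ≡ energy K
  energy-↭ {L} {K} p = trans (∑-↭ (deg L) p) (∑-cong K (λ e → ∑-↭ (share e) p))

  -- A pair with one arc in each list occurs in both orders, and `share` is symmetric.
  energy-++ : ∀ L K → energy (L ++ K) ≡ energy L + 2 * ∑ K (deg L) + energy K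
  energy-++ L K = begin
    ∑ (L ++ K) (deg (L ++ K))                     ≡⟨ ∑-++ L K _ ⟩
    ∑ L (deg (L ++ K)) + ∑ K (deg (L ++ K))       ≡⟨ cong₂ _+_ (expand L) (expand K) ⟩
    ∑ L (deg L) + ∑ L (deg K) + (∑ K (deg L) + ∑ K (deg K))
      ≡⟨ cong (λ z → energy L + z + (∑ K (deg L) + energy K)) flip ⟩
    energy L + ∑ K (deg L) + (∑ K (deg L) + energy K)
      ≡⟨ rearrange (energy L) (∑ K (deg L)) (energy K) ⟩
    energy L + 2 * ∑ K (deg L) + energy K ∎
    where
    open ≡-Reasoning
    expand : ∀ X → ∑ X (deg (L ++ K)) ≡ ∑ X (deg L) + ∑ X (deg K)
    expand X = trans (∑-cong X (deg-++ L K)) (∑-+ X (deg L) (deg K))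
    flip : ∑ L (deg K) ≡ ∑ K (deg L)
    flip = trans (∑-swap L K share) (∑-cong K (λ e → ∑-cong L (λ f → share-sym f e)))
    rearrange : ∀ a b c → a + b + (b + c) ≡ a + 2 * b + c
    rearrange = solve-∀

  energy-∷ : ∀ e L → energy (e ∷ L) ≡ 2 + 2 * deg L e + energy L
  energy-∷ e L = trans (energy-++ (e ∷ []) L) (cong₂ (λ a b → a + 2 * b + energy L) self others)
    where
    self : energy (e ∷ []) ≡ 2
    self = trans (+-identityʳ _) (trans (+-identityʳ _) (share-refl e))
    others : ∑ L (deg (e ∷ [])) ≡ deg L e
    others = ∑-cong L (λ f → trans (+-identityʳ _) (share-sym f e))

  -- An arc other than `e` shares at most one end with it, and at most one entry can be `e` itself,
  -- which contributes 2. The extra 1 accounts for that entry.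
  deg-unique : ∀ {L} e → Unique L → deg L e ≤ suc (length L)
  deg-unique {[]} e _ = z≤n
  deg-unique {f ∷ L} e (f∉ ∷ u) with ≡-dec _≟_ _≟_ e f
  ... | no ne = +-mono-≤ (share-≢ ne) (deg-unique e u)
  ... | yes refl = +-mono-≤ (share≤2 e e)
    (≤-trans (∑-≤const L 1 (λ g∈ → share-≢ (All.lookup f∉ g∈))) (≤-reflexive (*-identityʳ (length L))))

  -- The contribution of `f` is kept exact and the other arcs are estimated by `deg-unique`.
  deg-bound₁ : ∀ {L} e {f} → Unique L → f ∈ L → deg L e ≤ share e f + length L
  deg-bound₁ {L} e {f} u f∈ with K , p ← ∈⇒↭ f∈ with Unique-resp-↭ p u
  ... | _ ∷ uK = begin
    deg L e                   ≡⟨ ∑-↭ (share e) p ⟩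
    share e f + deg K e       ≤⟨ +-monoʳ-≤ (share e f) (deg-unique e uK) ⟩
    share e f + suc (length K) ≡⟨ cong (share e f +_) (sym (↭-length p)) ⟩
    share e f + length L ∎
    where open ≤-Reasoning

  deg-bound₂ : ∀ {L} e {f g} → Unique L → f ∈ L → g ∈ L → g ≢ f → suc (deg L e) ≤ share e f + share e g + length L
  deg-bound₂ {L} e {f} {g} u f∈ g∈ ne with K , p ← ∈⇒↭ f∈ with Unique-resp-↭ p u
  ... | _ ∷ uK = begin
    suc (deg L e)             ≡⟨ cong suc (∑-↭ (share e) p) ⟩
    suc (share e f + deg K e)       ≤⟨ s≤s (+-monoʳ-≤ (share e f) (deg-bound₁ e uK (∈-∷-≢ (∈-resp-↭ p g∈) ne))) ⟩
    suc (share e f + (share e g + length K)) ≡⟨ lemma (share e f) (share e g) (length K) ⟩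
    share e f + share e g + suc (length K) ≡⟨ cong (share e f + share e g +_) (sym (↭-length p)) ⟩
    share e f + share e g + length L ∎
    where
    open ≤-Reasoning
    lemma : ∀ a b c → suc (a + (b + c)) ≡ a + b + suc c
    lemma = solve-∀

  -- An arc of `L` disjoint from `e` would bring the degree down to `length L` by `deg-bound₁`.
  deg-full : ∀ {L} e → Unique L → suc (length L) ≤ deg L e → ∀ {f} → f ∈ L → 1 ≤ share e f
  deg-full {L} e u h f∈ = +-cancelʳ-≤ (length L) 1 _ (≤-trans h (deg-bound₁ e u f∈))

  energy-unique : ∀ {L} → Unique L → energy L ≤ length L * suc (length L)
  energy-unique {L} u = ∑-≤const L _ (λ {e} _ → deg-unique e u)

  -- A matching of the bipartite graph. This is weaker than a matching of the underlying graph,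
  -- since one vertex may be the tail of one arc and the head of another.
  record Separated (M : List Arc) : Set where
    constructor separated
    field
      tails : Unique (map proj₁ M)
      heads : Unique (map proj₂ M)

  module _ {M : List Arc} (sep : Separated M) where
    open Separated sep

    deg-separated : ∀ e → deg M e ≤ 2
    deg-separated e = ≤-trans (≤-reflexive (deg-split M e))
      (+-mono-≤ (∑δ≤1 (proj₁ e) tails) (∑δ≤1 (proj₂ e) heads))

    -- Each end of `e` meets at most one arc of `M`, so a degree of 2 can only arise as 1 + 1.
    covered : ∀ {e} → 2 ≤ deg M e → (proj₁ e ∈ map proj₁ M) × (proj₂ e ∈ map proj₂ M)
    covered {e} h = ∑δ≥1⇒∈ (+-cancelʳ-≤ 1 1 _ (≤-trans h′ (+-monoʳ-≤ _ (∑δ≤1 (proj₂ e) heads))))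
                  , ∑δ≥1⇒∈ (+-cancelˡ-≤ 1 1 _ (≤-trans h′ (+-monoˡ-≤ _ (∑δ≤1 (proj₁ e) tails))))
      where
      h′ : 2 ≤ ∑ (map proj₁ M) (δ (proj₁ e)) + ∑ (map proj₂ M) (δ (proj₂ e))
      h′ = ≤-trans h (≤-reflexive (deg-split M e))

    energy-separated : energy M ≤ length M * 2
    energy-separated = ∑-≤const M 2 (λ {e} _ → deg-separated e)

module _ {A : Set} where

  Unique-++⁻ʳ : ∀ (xs : List A) {ys} → Unique (xs ++ ys) → Unique ys
  Unique-++⁻ʳ []       u       = u
  Unique-++⁻ʳ (x ∷ xs) (_ ∷ u) = Unique-++⁻ʳ xs u

  Unique-++⁻ˡ : ∀ (xs : List A) {ys} → Unique (xs ++ ys) → Unique xs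
  Unique-++⁻ˡ xs {ys} u = Unique-++⁻ʳ ys (Unique-resp-↭ (Permₚ.++-comm xs ys) u)

  Unique-++⁻-disjoint : ∀ (xs : List A) {ys} → Unique (xs ++ ys) → ∀ {x} → x ∈ xs → x ∉ ys
  Unique-++⁻-disjoint (x ∷ xs) u (here refl) x∈ = Unique[x∷xs]⇒x∉xs u (∈-++⁺ʳ xs x∈)
  Unique-++⁻-disjoint (x ∷ xs) (_ ∷ u) (there z∈) = Unique-++⁻-disjoint xs u z∈

-- The upper bound for the energy

module Extremal {A : Set} (_≟_ : DecidableEquality A) where

  open Incidence _≟_

  TailStar HeadStar : List Arc → Set
  TailStar N = ∃ λ a → ∀ {e} → e ∈ N → proj₁ e ≡ a
  HeadStar N = ∃ λ b → ∀ {e} → e ∈ N → proj₂ e ≡ b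

  Intersecting : List Arc → Set
  Intersecting N = ∀ {e f} → e ∈ N → f ∈ N → 1 ≤ share e f

  -- A bipartite graph has no triangle. If `g` has another tail than `e`, the two have a common
  -- head, and an arc with a different head would have to share its tail with both.
  intersecting⇒star : ∀ {N e} → e ∈ N → Intersecting N → TailStar N ⊎ HeadStar N
  intersecting⇒star {N} {e} e∈ int with any? (λ g → ¬? (proj₁ e ≟ proj₁ g)) N
  ... | no ¬∃ = inj₁ (proj₁ e , λ {g} g∈ → sym (decidable-stable (proj₁ e ≟ proj₁ g) (λ ne → ¬∃ (lose g∈ ne))))
  ... | yes ∃g with g , g∈ , ne ← find ∃g = inj₂ (proj₂ e , heads)
    where
    e-g : proj₂ e ≡ proj₂ g
    e-g with share≥1 (int e∈ g∈)
    ... | inj₁ p = ⊥-elim (ne p)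
    ... | inj₂ q = q
    heads : ∀ {h} → h ∈ N → proj₂ h ≡ proj₂ e
    heads h∈ with share≥1 (int h∈ e∈) | share≥1 (int h∈ g∈)
    ... | inj₂ q | _      = q
    ... | inj₁ p | inj₂ q = trans q (sym e-g)
    ... | inj₁ p | inj₁ r = ⊥-elim (ne (trans (sym p) r))

  swap-injective : ∀ {e f : Arc} → swap e ≡ swap f → e ≡ f
  swap-injective refl = refl

  map-swap-unique : ∀ M {N} → Unique (M ++ N) → Unique (map swap M ++ map swap N)
  map-swap-unique M {N} u = subst Unique (map-++ swap M N) (Uniqueₚ.map⁺ swap-injective u)

  map-swap-separated : ∀ {M} → Separated M → Separated (map swap M)
  map-swap-separated {M} (separated t h) = separated (subst Unique (map-∘ M) h) (subst Unique (map-∘ M) t)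

  energy-map-swap : ∀ L → energy (map swap L) ≡ energy L
  energy-map-swap L = trans (∑-map swap L _)
    (∑-cong L (λ e → trans (∑-map swap L _) (∑-cong L (λ f → +-comm (δ (proj₂ e) (proj₂ f)) (δ (proj₁ e) (proj₁ f))))))

  map-swap-star : ∀ {N} → HeadStar N → TailStar (map swap N)
  map-swap-star (b , st) = b , λ e∈ → aux (∈-map⁻ swap e∈)
    where
    aux : ∀ {e} → ∃ (λ f → f ∈ _ × e ≡ swap f) → proj₁ e ≡ b
    aux (f , f∈ , refl) = st f∈

  star-heads-unique : ∀ {N : List Arc} {a} → Unique N → (∀ {e} → e ∈ N → proj₁ e ≡ a) → Unique (map proj₂ N)
  star-heads-unique {[]} _ _ = []
  star-heads-unique {e ∷ N} (e∉ ∷ u) st = Unique-∷ fresh (star-heads-unique u (λ f∈ → st (there f∈)))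
    where
    fresh : proj₂ e ∉ map proj₂ N
    fresh e∈ with f , f∈ , eq ← ∈-map⁻ proj₂ e∈ =
      All.lookup e∉ f∈ (cong₂ _,_ (trans (st (here refl)) (sym (st (there f∈)))) eq)

  star-fresh : ∀ {N : List Arc} {a y} → (a , y) ∉ N → (∀ {e} → e ∈ N → proj₁ e ≡ a) → y ∉ map proj₂ N
  star-fresh ∉N st y∈ with f , f∈ , refl ← ∈-map⁻ proj₂ y∈ with refl ← st f∈ = ∉N f∈

  Saturated : List Arc → List Arc → Set
  Saturated M N = ∀ {e} → e ∈ N → (proj₁ e ∈ map proj₁ M) × (proj₂ e ∈ map proj₂ M)

  -- `M` has an arc `f` at the centre `a`. Since `M` and `N` are disjoint, the head of `f` is not a
  -- leaf of the star, so together with the leaves it gives one head more than `N` has arcs, and all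
  -- of these are heads of arcs of `M`.
  saturated-star-size : ∀ {M N e} → e ∈ N → Unique (M ++ N) → Saturated M N → TailStar N → suc (length N) ≤ length M
  saturated-star-size {M} {N} {e} e∈ u sat (a , st) with f , f∈ , eq ← ∈-map⁻ proj₁ (proj₁ (sat e∈)) =
    subst₂ _≤_ (cong suc (length-map proj₂ N)) (length-map proj₂ M)
      (Unique-⊆-length (Unique-∷ (star-fresh a∉ st) (star-heads-unique (Unique-++⁻ʳ M u) st)) sub)
    where
    a∉ : (a , proj₂ f) ∉ N
    a∉ n∈ = Unique-++⁻-disjoint M u f∈ (subst (λ z → (z , proj₂ f) ∈ N) (trans (sym (st e∈)) eq) n∈)
    sub : ∀ {x} → x ∈ proj₂ f ∷ map proj₂ N → x ∈ map proj₂ M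
    sub (here refl) = ∈-map⁺ proj₂ f∈
    sub (there x∈) with g , g∈ , refl ← ∈-map⁻ proj₂ x∈ = proj₂ (sat g∈)

  -- Reversing all arcs turns a star at a head into a star at a tail and preserves saturation.
  saturated-intersecting-size : ∀ {M N e} → e ∈ N → Unique (M ++ N) → Saturated M N → Intersecting N →
                                suc (length N) ≤ length M
  saturated-intersecting-size {M} {N} e∈ u sat int with intersecting⇒star e∈ int
  ... | inj₁ st = saturated-star-size e∈ u sat st
  ... | inj₂ st = subst₂ _≤_ (cong suc (length-map swap N)) (length-map swap M)
    (saturated-star-size (∈-map⁺ swap e∈) (map-swap-unique M u) sat′ (map-swap-star st))
    where
    sat′ : Saturated (map swap M) (map swap N)
    sat′ e∈ with f , f∈ , refl ← ∈-map⁻ swap e∈ =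
      subst (_ ∈_) (map-∘ M) (proj₂ (sat f∈)) , subst (_ ∈_) (map-∘ M) (proj₁ (sat f∈))

  -- (k + 1)² + (k + 1) + 4 μ: a star with k + 1 edges and μ further disjoint edges, each at a leaf of the star.
  bound : ℕ → ℕ → ℕ
  bound μ k = k * k + 3 * k + 4 * μ + 2

  module _ {M : List Arc} {μ : ℕ} (|M| : length M ≡ suc μ) (sep : Separated M) where

    -- The ordered pairs that involve `e` contribute twice its degree, except that the pair of `e`
    -- with itself, of value 2, is then counted twice. The correction stands on the left to avoid
    -- subtraction.
    energy-remove : ∀ {N N′ e} → N ↭ e ∷ N′ → 2 + energy (M ++ N) ≡ 2 * deg (M ++ N) e + energy (M ++ N′)
    energy-remove {N} {N′} {e} p = begin
      2 + energy (M ++ N)                               ≡⟨ cong (2 +_) (energy-↭ q) ⟩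
      2 + energy (e ∷ M ++ N′)                          ≡⟨ cong (2 +_) (energy-∷ e (M ++ N′)) ⟩
      2 + (2 + 2 * deg (M ++ N′) e + energy (M ++ N′))  ≡⟨ alg (deg (M ++ N′) e) (energy (M ++ N′)) ⟩
      2 * (2 + deg (M ++ N′) e) + energy (M ++ N′)
        ≡⟨ cong (λ z → 2 * z + energy (M ++ N′))
             (sym (trans (∑-↭ (share e) q) (cong (_+ deg (M ++ N′) e) (share-refl e)))) ⟩
      2 * deg (M ++ N) e + energy (M ++ N′) ∎
      where
      open ≡-Reasoning
      q : M ++ N ↭ e ∷ M ++ N′
      q = ↭-trans (Permₚ.++⁺ˡ M p) (shift e M N′)
      alg : ∀ d s → 2 + (2 + 2 * d + s) ≡ 2 * (2 + d) + s
      alg = solve-∀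

    remove-unique : ∀ {N N′ e} → N ↭ e ∷ N′ → Unique (M ++ N) → Unique (M ++ N′)
    remove-unique {N′ = N′} {e} p u with _ ∷ u′ ← Unique-resp-↭ (↭-trans (Permₚ.++⁺ˡ M p) (shift e M N′)) u = u′

    -- From `k` to `suc k` the bound grows by `2 * k + 4`, which is exactly what the removal of an
    -- arc of degree `3 + k` costs. The variables are arbitrary numbers so that the same computation
    -- can also be used with some slack in the energy.
    bound-step : ∀ {s s′ w k} → 2 + s ≡ 2 * w + s′ → s′ ≤ bound μ k → w ≤ 3 + k → s ≤ bound μ (suc k)
    bound-step {s} {s′} {w} {k} eq ih h = cancel-≤ 2 (+-mono-≤ (*-monoʳ-≤ 2 h) ih) (trans (+-comm s 2) eq) (alg k μ)
      where
      alg : ∀ k μ → suc k * suc k + 3 * suc k + 4 * μ + 2 + 2 ≡ 2 * (3 + k) + (k * k + 3 * k + 4 * μ + 2)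
      alg = solve-∀

    -- The three terms of `energy-++` are estimated separately. The resulting total differs from
    -- `bound μ k` only in having `2 * k` in place of `2 * μ`.
    energy-saturated : ∀ {N} → Unique N → length N ≤ μ → energy (M ++ N) ≤ bound μ (length N)
    energy-saturated {N} u k≤μ = begin
      energy (M ++ N)                             ≡⟨ energy-++ M N ⟩
      energy M + 2 * ∑ N (deg M) + energy N
        ≤⟨ +-mono-≤ (+-mono-≤ (energy-separated sep)
             (*-monoʳ-≤ 2 (∑-≤const N 2 (λ {e} _ → deg-separated sep e)))) (energy-unique u) ⟩
      length M * 2 + 2 * (k * 2) + k * suc k      ≡⟨ cong (λ z → z * 2 + 2 * (k * 2) + k * suc k) |M| ⟩
      suc μ * 2 + 2 * (k * 2) + k * suc k         ≡⟨ alg₁ μ k ⟩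
      k * k + 3 * k + 2 * μ + 2 + 2 * k           ≤⟨ +-monoʳ-≤ (k * k + 3 * k + 2 * μ + 2) (*-monoʳ-≤ 2 k≤μ) ⟩
      k * k + 3 * k + 2 * μ + 2 + 2 * μ           ≡⟨ alg₂ μ k ⟩
      bound μ k ∎
      where
      open ≤-Reasoning
      k : ℕ
      k = length N
      alg₁ : ∀ μ k → suc μ * 2 + 2 * (k * 2) + k * suc k ≡ k * k + 3 * k + 2 * μ + 2 + 2 * k
      alg₁ = solve-∀
      alg₂ : ∀ μ k → k * k + 3 * k + 2 * μ + 2 + 2 * μ ≡ k * k + 3 * k + 4 * μ + 2
      alg₂ = solve-∀

    -- `M` contributes at most 2 to the degree and `N` at most `suc (length N)`, so a degree this
    -- large forces both maxima.
    heavy⇒saturated : ∀ {N e} → Unique N → 3 + length N ≤ deg (M ++ N) e →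
                      (2 ≤ deg M e) × (suc (length N) ≤ deg N e)
    heavy⇒saturated {N} {e} u h =
        +-cancelʳ-≤ (suc (length N)) 2 _ (≤-trans h′ (+-monoʳ-≤ (deg M e) (deg-unique e u)))
      , +-cancelˡ-≤ 2 (suc (length N)) _ (≤-trans h′ (+-monoˡ-≤ (deg N e) (deg-separated sep e)))
      where
      h′ : 3 + length N ≤ deg M e + deg N e
      h′ = ≤-trans h (≤-reflexive (deg-++ M N e))

    -- Remove an edge e outside M with deg e ≤ k + 2, if there is one; otherwise the k edges outside M
    -- form a star all of whose vertices are covered by M, so k < |M|.
    energy≤bound : ∀ {N} k → length N ≡ k → Unique (M ++ N) → energy (M ++ N) ≤ bound μ k
    energy≤bound {[]} zero refl u = energy-saturated [] z≤n
    energy≤bound {N@(e ∷ _)} (suc k) |N| u with any? (λ f → deg (M ++ N) f ≤? 3 + k) N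
    ... | yes ∃f with f , f∈ , light ← find ∃f with N′ , p ← ∈⇒↭ f∈ =
      bound-step (energy-remove p) (energy≤bound k (suc-injective (trans (sym (↭-length p)) |N|)) (remove-unique p u)) light
    ... | no ¬∃ = subst (λ z → energy (M ++ N) ≤ bound μ z) |N| (energy-saturated uN k≤μ)
      where
      uN : Unique N
      uN = Unique-++⁻ʳ M u
      heavy : ∀ {f} → f ∈ N → (2 ≤ deg M f) × (suc (length N) ≤ deg N f)
      heavy f∈ = heavy⇒saturated uN (≰⇒> (λ l → ¬∃ (lose f∈ (≤-trans l (+-monoʳ-≤ 2 (≤-reflexive |N|))))))
      k≤μ : length N ≤ μ
      k≤μ = ≤-pred (≤-trans (saturated-intersecting-size (here refl) u (λ f∈ → covered sep (proj₁ (heavy f∈)))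
                       (λ {f} f∈ g∈ → deg-full f uN (proj₂ (heavy f∈)) g∈)) (≤-reflexive |M|))

-- The structure in the case of equality

module Equality {A : Set} (_≟_ : DecidableEquality A) where

  open Incidence _≟_
  open Extremal _≟_

  -- The extremal shape: `N` and one arc of `M` leave a common centre, and every other arc of `M`
  -- ends at a leaf of this star. The `spokes` are these other arcs of `M`, not the arcs at the
  -- centre. The shape with a head as centre is covered by reversing all arcs.
  record Hub (M N : List Arc) : Set where
    constructor hub
    field
      {centre mate} : A
      {spokes}      : List Arc
      M↭            : M ↭ (centre , mate) ∷ spokes
      star          : ∀ {e} → e ∈ N → proj₁ e ≡ centre
      attached      : ∀ {e} → e ∈ spokes → proj₂ e ∈ map proj₂ N

  module _ {M N : List Arc} {μ : ℕ} (|M| : length M ≡ suc μ) (sep : Separated M) (u : Unique (M ++ N))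
           (μ≥2 : 2 ≤ μ) (k≥ : 2 + μ ≤ length N) (tight : energy (M ++ N) ≡ bound μ (length N)) where

    private
      k : ℕ
      k = length N

      uN : Unique N
      uN = Unique-++⁻ʳ M u

    -- Deleting an arc of degree at most `1 + k` lowers the energy by at most `2 * k`, whereas the
    -- bound drops by `2 * k + 2`. The energy would then lie at least 2 below the bound.
    deg≥ : ∀ {f} → f ∈ N → 2 + k ≤ deg (M ++ N) f
    deg≥ {f} f∈ with 2 + k ≤? deg (M ++ N) f
    ... | yes h = h
    ... | no ¬h with N′ , p ← ∈⇒↭ f∈ = ⊥-elim (<⇒≱ {bound μ k} (s≤s (m≤n+m _ 1)) absurd)
      where
      -- The removal identity with the energy raised by 2 and the degree by 1, so that `bound-step`
      -- yields the slack of 2.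
      eq : 2 + (2 + energy (M ++ N)) ≡ 2 * suc (deg (M ++ N) f) + energy (M ++ N′)
      eq = trans (cong (2 +_) (energy-remove |M| sep p)) (alg (deg (M ++ N) f) (energy (M ++ N′)))
        where
        alg : ∀ w s → 2 + (2 * w + s) ≡ 2 * suc w + s
        alg = solve-∀
      absurd : 2 + bound μ k ≤ bound μ k
      absurd = subst₂ _≤_ (cong (2 +_) tight) (cong (bound μ) (sym (↭-length p)))
        (bound-step |M| sep eq (energy≤bound |M| sep (length N′) refl (remove-unique |M| sep p u))
          (≤-trans (≰⇒> ¬h) (+-monoʳ-≤ 2 (≤-reflexive (↭-length p)))))

    deg-split≥ : ∀ {f} → f ∈ N → 2 + k ≤ deg M f + deg N f
    deg-split≥ {f} f∈ = ≤-trans (deg≥ f∈) (≤-reflexive (deg-++ M N f))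

    module _ {e f} (e∈ : e ∈ N) (f∈ : f ∈ N) (apart : share e f ≡ 0) where

      -- The disjoint arc `f` keeps `deg N e` at most `k`, so `M` must supply the missing 2.
      apart⇒saturated : 2 ≤ deg M e
      apart⇒saturated = +-cancelʳ-≤ k 2 _ (≤-trans (deg-split≥ e∈) (+-monoʳ-≤ (deg M e)
        (≤-trans (deg-bound₁ e uN f∈) (≤-reflexive (cong (_+ k) apart)))))

      -- As `M` supplies at most 2, `deg N e` is at least `k`; a second arc of `N` disjoint from `e`
      -- would bring it below `k`.
      apart-unique : ∀ {g} → g ∈ N → g ≢ f → 1 ≤ share e g
      apart-unique {g} g∈ g≢f = +-cancelʳ-≤ k 1 _ (begin
        1 + k
          ≤⟨ s≤s (+-cancelˡ-≤ 2 k _ (≤-trans (deg-split≥ e∈) (+-monoˡ-≤ (deg N e) (deg-separated sep e)))) ⟩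
        suc (deg N e)                 ≤⟨ deg-bound₂ e uN f∈ g∈ g≢f ⟩
        share e f + share e g + k     ≡⟨ cong (λ z → z + share e g + k) apart ⟩
        share e g + k ∎)
        where open ≤-Reasoning

    -- Two disjoint edges ab, cd outside M would force N = {ab, cd, ad, cb}, whose four vertices
    -- are covered by four different edges of M; but then |N| ≤ |M|.
    intersecting : Intersecting N
    intersecting {e} {f} e∈ f∈ with share e f in apart
    ... | suc _ = s≤s z≤n
    ... | zero  = ⊥-elim (<-irrefl refl (≤-trans k≥ (≤-trans |N|≤4 (≤-trans 4≤M (≤-reflexive |M|)))))
      where
      apart′ : share f e ≡ 0
      apart′ = trans (share-sym f e) apart
      p≢ : proj₁ e ≢ proj₁ f
      p≢ = proj₁ (share≡0 apart)
      q≢ : proj₂ e ≢ proj₂ f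
      q≢ = proj₂ (share≡0 apart)
      ef fe : Arc
      ef = proj₁ e , proj₂ f
      fe = proj₁ f , proj₂ e
      grid : List Arc
      grid = e ∷ f ∷ ef ∷ fe ∷ []
      N⊆grid : ∀ {g} → g ∈ N → g ∈ grid
      N⊆grid {g} g∈ with ≡-dec _≟_ _≟_ g e | ≡-dec _≟_ _≟_ g f
      ... | yes g≡e | _       = here g≡e
      ... | no _    | yes g≡f = there (here g≡f)
      ... | no g≢e  | no g≢f
        with share≥1 (apart-unique e∈ f∈ apart g∈ g≢f) | share≥1 (apart-unique f∈ e∈ apart′ g∈ g≢e)
      ... | inj₁ a | inj₁ b = ⊥-elim (p≢ (trans a (sym b)))
      ... | inj₁ a | inj₂ b = there (there (here (cong₂ _,_ (sym a) (sym b))))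
      ... | inj₂ a | inj₁ b = there (there (there (here (cong₂ _,_ (sym b) (sym a)))))
      ... | inj₂ a | inj₂ b = ⊥-elim (q≢ (trans a (sym b)))
      |N|≤4 : length N ≤ 4
      |N|≤4 = Unique-⊆-length uN N⊆grid
      -- `N` has at least `2 + μ` arcs, hence at least four, so it fills the grid.
      grid⊆N : ∀ {g} → g ∈ grid → g ∈ N
      grid⊆N = Unique-⊆-full (≡-dec _≟_ _≟_) uN N⊆grid (≤-trans (+-monoʳ-≤ 2 μ≥2) k≥)
      clash : ∀ {g} → g ∈ M → g ∈ N → ⊥
      clash = Unique-++⁻-disjoint M u
      cov-e = covered sep (apart⇒saturated e∈ f∈ apart)
      cov-f = covered sep (apart⇒saturated f∈ e∈ apart′)
      -- If one arc of `M` covered both `a` and `b`, it would be the arc `(a , b)`, which already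
      -- lies in `N`.
      cross : ∀ {g h a b} → g ∈ M → (a , b) ∈ N → a ≡ proj₁ g → b ≡ proj₂ h → g ≢ h
      cross g∈ ab∈ refl refl refl = clash g∈ ab∈
      4≤M : 4 ≤ length M
      4≤M with e₁ , e₁∈ , e₁≡ ← ∈-map⁻ proj₁ (proj₁ cov-e) | e₂ , e₂∈ , e₂≡ ← ∈-map⁻ proj₂ (proj₂ cov-e)
             | f₁ , f₁∈ , f₁≡ ← ∈-map⁻ proj₁ (proj₁ cov-f) | f₂ , f₂∈ , f₂≡ ← ∈-map⁻ proj₂ (proj₂ cov-f)
        = Unique-⊆-length {xs = e₁ ∷ e₂ ∷ f₁ ∷ f₂ ∷ []}
            (  (cross e₁∈ (grid⊆N (here refl)) e₁≡ e₂≡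
               ∷ (λ { refl → p≢ (trans e₁≡ (sym f₁≡)) })
               ∷ cross e₁∈ (grid⊆N (there (there (here refl)))) e₁≡ f₂≡ ∷ [])
            ∷ (≢-sym (cross f₁∈ (grid⊆N (there (there (there (here refl))))) f₁≡ e₂≡)
               ∷ (λ { refl → q≢ (trans e₂≡ (sym f₂≡)) }) ∷ [])
            ∷ (cross f₁∈ (grid⊆N (there (here refl))) f₁≡ f₂≡ ∷ [])
            ∷ [] ∷ [])
            (λ { (here refl) → e₁∈ ; (there (here refl)) → e₂∈ ; (there (there (here refl))) → f₁∈
               ; (there (there (there (here refl)))) → f₂∈ })

    -- In the bound, `energy M` takes up at most `2 * suc μ` and `energy N` at most `k * suc k`; the
    -- remaining `2 * (k + μ)` must come from the doubled mixed term.
    covering-total : k + μ ≤ ∑ N (deg M)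
    covering-total = *-cancelˡ-≤ 2 (cancel-≤ (suc μ * 2 + k * suc k)
      (≤-trans (≤-reflexive (trans (sym tight) (energy-++ M N)))
        (+-mono-≤ (+-monoˡ-≤ (2 * ∑ N (deg M)) (≤-trans (energy-separated sep) (≤-reflexive (cong (_* 2) |M|))))
                  (energy-unique uN)))
      (alg₁ k μ) (alg₂ (suc μ * 2) (2 * ∑ N (deg M)) (k * suc k)))
      where
      alg₁ : ∀ k μ → 2 * (k + μ) + (suc μ * 2 + k * suc k) ≡ k * k + 3 * k + 4 * μ + 2
      alg₁ = solve-∀
      alg₂ : ∀ a b c → b + (a + c) ≡ a + b + c
      alg₂ = solve-∀

    -- The mixed term is counted again from the side of `M`: an arc of `M` contributes `k` if it
    -- leaves the centre, and 1 if it ends at a leaf. The total from `covering-total` is just large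
    -- enough to need one arc at the centre and all others at leaves.
    tailStar⇒hub : TailStar N → Hub M N
    tailStar⇒hub (a , st) = hub M↭ st att
      where
      uH : Unique (map proj₂ N)
      uH = star-heads-unique uN st
      hits : Arc → ℕ
      hits e = ∑ (map proj₂ N) (δ (proj₂ e))
      hits≤1 : ∀ e → hits e ≤ 1
      hits≤1 e = ∑δ≤1 (proj₂ e) uH
      atCentre : ℕ
      atCentre = ∑ (map proj₁ M) (δ a)
      total : ∑ N (deg M) ≡ k * atCentre + ∑ M hits
      total = begin
        ∑ N (deg M)  ≡⟨ ∑-cong N (λ f → ∑-+ M _ _) ⟩
        ∑ N (λ f → ∑ M (λ e → δ (proj₁ f) (proj₁ e)) + ∑ M (λ e → δ (proj₂ f) (proj₂ e))) ≡⟨ ∑-+ N _ _ ⟩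
        ∑ N (λ f → ∑ M (λ e → δ (proj₁ f) (proj₁ e))) + ∑ N (λ f → ∑ M (λ e → δ (proj₂ f) (proj₂ e)))
          ≡⟨ cong₂ _+_ (trans (∑-cong-∈ N (λ f∈ → trans (cong (λ z → ∑ M (λ e → δ z (proj₁ e))) (st f∈))
                                                 (sym (∑-map proj₁ M (δ a)))))
                              (∑-const atCentre N))
                       (trans (∑-swap N M _) (∑-cong M (λ e → trans (∑-cong N (λ f → δ-sym (proj₂ f) (proj₂ e)))
                                                                    (sym (∑-map proj₂ N _))))) ⟩
        k * atCentre + ∑ M hits ∎
        where open ≡-Reasoning
      total≥ : k + μ ≤ k * atCentre + ∑ M hits
      total≥ = ≤-trans covering-total (≤-reflexive total)
      -- With no arc of `M` at the centre the total would be at most `suc μ`, but it is at least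
      -- `k + μ` and `k` is at least `2 + μ`.
      atCentre≥1 : 1 ≤ atCentre
      atCentre≥1 with atCentre in eq
      ... | suc _ = s≤s z≤n
      ... | zero  = ⊥-elim (<⇒≱ (≤-trans (s≤s (s≤s (m≤n+m μ μ))) (≤-trans (+-monoˡ-≤ μ k≥) total≥′))
                      (≤-trans (∑-≤const M 1 (λ {e} _ → hits≤1 e)) (≤-reflexive (trans (*-identityʳ _) |M|))))
        where
        total≥′ : k + μ ≤ ∑ M hits
        total≥′ = ≤-trans total≥ (≤-reflexive (trans (cong (λ z → k * z + ∑ M hits) eq) (cong (_+ ∑ M hits) (*-zeroʳ k))))
      a∈M : ∃ λ e → e ∈ M × a ≡ proj₁ e
      a∈M = ∈-map⁻ proj₁ (∑δ≥1⇒∈ atCentre≥1)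
      y : A
      y = proj₂ (proj₁ a∈M)
      ay∈M : (a , y) ∈ M
      ay∈M = subst (λ z → (z , y) ∈ M) (sym (proj₂ (proj₂ a∈M))) (proj₁ (proj₂ a∈M))
      R : List Arc
      R = proj₁ (∈⇒↭ ay∈M)
      M↭ : M ↭ (a , y) ∷ R
      M↭ = proj₂ (∈⇒↭ ay∈M)
      hits-mate : hits (a , y) ≡ 0
      hits-mate = ∑δ-∉ (star-fresh (Unique-++⁻-disjoint M u ay∈M) st)
      -- At most one arc of `M` leaves the centre, which accounts for at most `k`. Since `y` is not
      -- a leaf, the remaining `μ` must all come from `R`.
      |R|≤ : length R ≤ ∑ R hits
      |R|≤ = +-cancelˡ-≤ k _ _ (begin
        k + length R             ≡⟨ cong (k +_) (suc-injective (trans (sym (↭-length M↭)) |M|)) ⟩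
        k + μ                    ≤⟨ total≥ ⟩
        k * atCentre + ∑ M hits  ≤⟨ +-monoˡ-≤ (∑ M hits) (*-monoʳ-≤ k (∑δ≤1 a (Separated.tails sep))) ⟩
        k * 1 + ∑ M hits         ≡⟨ cong₂ _+_ (*-identityʳ k) (trans (∑-↭ hits M↭) (cong (_+ ∑ R hits) hits-mate)) ⟩
        k + ∑ R hits ∎)
        where open ≤-Reasoning
      att : ∀ {e} → e ∈ R → proj₂ e ∈ map proj₂ N
      att e∈ = ∑δ≥1⇒∈ (∑-tight {f = hits} R (λ {e} _ → hits≤1 e) |R|≤ e∈)

  tight⇒hub : ∀ {M N μ} → length M ≡ suc μ → Separated M → Unique (M ++ N) → 2 ≤ μ → 2 + μ ≤ length N →
              energy (M ++ N) ≡ bound μ (length N) → Hub M N ⊎ Hub (map swap M) (map swap N)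
  tight⇒hub {M} {N@(_ ∷ _)} {μ} |M| sep u μ≥2 k≥ tight
    with intersecting⇒star (here refl) (intersecting |M| sep u μ≥2 k≥ tight)
  ... | inj₁ st = inj₁ (tailStar⇒hub |M| sep u μ≥2 k≥ tight st)
  ... | inj₂ st = inj₂ (tailStar⇒hub (trans (length-map swap M) |M|) (map-swap-separated sep) (map-swap-unique M u) μ≥2
      (≤-trans k≥ (≤-reflexive (sym (length-map swap N))))
      (trans (cong energy (sym (map-++ swap M N))) (trans (energy-map-swap (M ++ N))
        (trans tight (cong (bound μ) (sym (length-map swap N))))))
      (map-swap-star st))

-- Arc lists of digraphs and the Zagreb index as energy

<⇒<ᵇ≡true : ∀ {m n} → m < n → (m <ᵇ n) ≡ true
<⇒<ᵇ≡true p = Equivalence.to T-≡ (<⇒<ᵇ p)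

≤⇒<ᵇ≡false : ∀ {m n} → n ≤ m → (m <ᵇ n) ≡ false
≤⇒<ᵇ≡false {m} {n} p with m <ᵇ n in eq
... | false = refl
... | true  = ⊥-elim (<⇒≱ (<ᵇ⇒< m n (Equivalence.from T-≡ eq)) p)

∑-filter : ∀ {A : Set} {P : Pred A 0ℓ} (P? : Decidable P) xs (h : A → ℕ) →
           ∑ (filter P? xs) h ≡ ∑ xs (λ x → ind (does (P? x)) * h x)
∑-filter P? [] h = refl
∑-filter P? (x ∷ xs) h with does (P? x)
... | true  = cong₂ _+_ (sym (+-identityʳ (h x))) (∑-filter P? xs h)
... | false = ∑-filter P? xs h

∑-cartesianProduct : ∀ {A B : Set} (xs : List A) (ys : List B) h →
                     ∑ (cartesianProduct xs ys) h ≡ ∑ xs (λ x → ∑ ys (λ y → h (x , y)))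
∑-cartesianProduct []       ys h = refl
∑-cartesianProduct (x ∷ xs) ys h = trans (∑-++ (map (x ,_) ys) _ h)
  (cong₂ _+_ (∑-map (x ,_) ys h) (∑-cartesianProduct xs ys h))

∑-*ʳ : ∀ {A : Set} c (xs : List A) f → ∑ xs (λ x → f x * c) ≡ ∑ xs f * c
∑-*ʳ c xs f = trans (∑-cong xs (λ x → *-comm (f x) c)) (trans (∑-*ˡ c xs f) (*-comm c (∑ xs f)))

module FinArcs (n : ℕ) where

  open Incidence (Finₚ._≟_ {n}) public

  ∑-pick : ∀ u (g : Fin n → ℕ) → ∑ (allFin n) (λ x → δ u x * g x) ≡ g u
  ∑-pick u g with ys , p ← ∈⇒↭ (∈-allFin u) = trans (∑-↭ _ p)
    (trans (cong₂ _+_ (trans (cong (_* g u) (δ-refl u)) (+-identityʳ (g u)))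
             (trans (∑-cong-∈ ys (λ {x} x∈ → cong (_* g x) (δ-≢ {u} {x} (λ { refl → Unique[x∷xs]⇒x∉xs u∷ys x∈ })))) (∑-zero ys)))
           (+-identityʳ (g u)))
    where
    u∷ys : Unique (u ∷ ys)
    u∷ys = Unique-resp-↭ p (Uniqueₚ.allFin⁺ n)

  arcs : Rel n → List Arc
  arcs D = filter (λ e → T? (D (proj₁ e) (proj₂ e))) (cartesianProduct (allFin n) (allFin n))

  arcs-unique : ∀ D → Unique (arcs D)
  arcs-unique D = Uniqueₚ.filter⁺ (λ e → T? (D (proj₁ e) (proj₂ e)))
    (Uniqueₚ.cartesianProduct⁺ (Uniqueₚ.allFin⁺ n) (Uniqueₚ.allFin⁺ n))

  ∈-arcs⁺ : ∀ D {u v} → D u v ≡ true → (u , v) ∈ arcs D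
  ∈-arcs⁺ D {u} {v} eq = ∈-filter⁺ (λ e → T? (D (proj₁ e) (proj₂ e))) (∈-cartesianProduct⁺ (∈-allFin u) (∈-allFin v))
    (Equivalence.from T-≡ eq)

  ∈-arcs⁻ : ∀ D {u v} → (u , v) ∈ arcs D → D u v ≡ true
  ∈-arcs⁻ D uv∈ = Equivalence.to T-≡ (proj₂ (∈-filter⁻ (λ e → T? (D (proj₁ e) (proj₂ e)))
    {xs = cartesianProduct (allFin n) (allFin n)} uv∈))

  ∑∑ : (Fin n → Fin n → ℕ) → ℕ
  ∑∑ h = ∑ (allFin n) (λ u → ∑ (allFin n) (h u))

  ∑∑-cong : ∀ {g h : Fin n → Fin n → ℕ} → (∀ u v → g u v ≡ h u v) → ∑∑ g ≡ ∑∑ h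
  ∑∑-cong eq = ∑-cong (allFin n) (λ u → ∑-cong (allFin n) (eq u))

  ∑∑-+ : ∀ (g h : Fin n → Fin n → ℕ) → ∑∑ (λ u v → g u v + h u v) ≡ ∑∑ g + ∑∑ h
  ∑∑-+ g h = trans (∑-cong (allFin n) (λ u → ∑-+ (allFin n) (g u) (h u))) (∑-+ (allFin n) _ _)

  ∑∑-swap : ∀ (h : Fin n → Fin n → ℕ) → ∑∑ h ≡ ∑∑ (λ u v → h v u)
  ∑∑-swap h = ∑-swap (allFin n) (allFin n) h

  ∑-arcs : ∀ D h → ∑ (arcs D) h ≡ ∑∑ (λ u v → ind (D u v) * h (u , v))
  ∑-arcs D h = trans (∑-filter (λ e → T? (D (proj₁ e) (proj₂ e))) (cartesianProduct (allFin n) (allFin n)) h)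
    (∑-cartesianProduct (allFin n) (allFin n) _)

  ∑∑-tail : ∀ (D : Rel n) (g : Fin n → ℕ) → ∑∑ (λ u v → ind (D u v) * g u) ≡ ∑ (allFin n) (λ u → outdeg D u * g u)
  ∑∑-tail D g = ∑-cong (allFin n) (λ u → ∑-*ʳ (g u) (allFin n) (λ v → ind (D u v)))

  ∑∑-head : ∀ (D : Rel n) (g : Fin n → ℕ) → ∑∑ (λ u v → ind (D u v) * g v) ≡ ∑ (allFin n) (λ v → indeg D v * g v)
  ∑∑-head D g = trans (∑∑-swap _) (∑∑-tail (λ u v → D v u) g)

  deg-arcs : ∀ D u v → deg (arcs D) (u , v) ≡ outdeg D u + indeg D v
  deg-arcs D u v = trans (∑-+ (arcs D) _ _) (cong₂ _+_
    (trans (∑-arcs D _) (trans (∑∑-tail D (δ u))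
      (trans (∑-cong (allFin n) (λ x → *-comm (outdeg D x) (δ u x))) (∑-pick u (outdeg D)))))
    (trans (∑-arcs D _) (trans (∑∑-head D (δ v))
      (trans (∑-cong (allFin n) (λ x → *-comm (indeg D x) (δ v x))) (∑-pick v (indeg D))))))

  -- The degree of an arc is the out-degree of its tail plus the in-degree of its head. A vertex is
  -- a tail as often as its out-degree says and a head as often as its in-degree says, which
  -- produces the squares.
  twiceM1≡energy : ∀ D → twiceM1 D ≡ energy (arcs D)
  twiceM1≡energy D = sym (begin
    energy (arcs D)                                                  ≡⟨ ∑-cong (arcs D) (λ e → deg-arcs D (proj₁ e) (proj₂ e)) ⟩
    ∑ (arcs D) (λ e → outdeg D (proj₁ e) + indeg D (proj₂ e))        ≡⟨ ∑-+ (arcs D) _ _ ⟩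
    ∑ (arcs D) (λ e → outdeg D (proj₁ e)) + ∑ (arcs D) (λ e → indeg D (proj₂ e))
      ≡⟨ cong₂ _+_ (trans (∑-arcs D _) (∑∑-tail D (outdeg D))) (trans (∑-arcs D _) (∑∑-head D (indeg D))) ⟩
    ∑ (allFin n) (λ u → outdeg D u * outdeg D u) + ∑ (allFin n) (λ u → indeg D u * indeg D u)
      ≡⟨ sym (∑-+ (allFin n) _ _) ⟩
    twiceM1 D ∎)
    where open ≡-Reasoning

  -- Arcs are sorted by whether the tail or the head has the smaller label. Exchanging the variables
  -- in the second group collects both directions of each pair, and an edge has exactly one of them
  -- as an arc.
  length-arcs : ∀ {G D} → IsOrientation n G D → length (arcs D) ≡ numEdges G
  length-arcs {G} {D} or = begin
    length (arcs D)                            ≡⟨ sym (trans (∑-const 1 (arcs D)) (*-identityʳ _)) ⟩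
    ∑ (arcs D) (λ _ → 1)                       ≡⟨ ∑-arcs D _ ⟩
    ∑∑ (λ u v → ind (D u v) * 1)               ≡⟨ ∑∑-cong once ⟩
    ∑∑ (λ u v → lt u v * ind (D u v) + lt v u * ind (D u v))
      ≡⟨ ∑∑-+ (λ u v → lt u v * ind (D u v)) (λ u v → lt v u * ind (D u v)) ⟩
    ∑∑ (λ u v → lt u v * ind (D u v)) + ∑∑ (λ u v → lt v u * ind (D u v))
      ≡⟨ cong (∑∑ (λ u v → lt u v * ind (D u v)) +_) (∑∑-swap (λ u v → lt v u * ind (D u v))) ⟩
    ∑∑ (λ u v → lt u v * ind (D u v)) + ∑∑ (λ u v → lt u v * ind (D v u))
      ≡⟨ sym (∑∑-+ (λ u v → lt u v * ind (D u v)) (λ u v → lt u v * ind (D v u))) ⟩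
    ∑∑ (λ u v → lt u v * ind (D u v) + lt u v * ind (D v u)) ≡⟨ ∑∑-cong (λ u v → sym (edge u v)) ⟩
    numEdges G ∎
    where
    open ≡-Reasoning
    open IsOrientation or
    lt : Fin n → Fin n → ℕ
    lt u v = ind (toℕ u <ᵇ toℕ v)
    once : ∀ u v → ind (D u v) * 1 ≡ lt u v * ind (D u v) + lt v u * ind (D u v)
    once u v with D u v in eq | <-cmp (toℕ u) (toℕ v)
    ... | false | _ = sym (cong₂ _+_ (*-zeroʳ (lt u v)) (*-zeroʳ (lt v u)))
    ... | true | tri< a _ _ rewrite <⇒<ᵇ≡true a | ≤⇒<ᵇ≡false (<⇒≤ a) = refl
    ... | true | tri> _ _ a rewrite <⇒<ᵇ≡true a | ≤⇒<ᵇ≡false (<⇒≤ a) = refl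
    ... | true | tri≈ _ a _ with refl ← toℕ-injective a with () ← trans (sym eq) (asym u u eq)
    edge : ∀ u v → ind ((toℕ u <ᵇ toℕ v) ∧ G u v) ≡ lt u v * ind (D u v) + lt u v * ind (D v u)
    edge u v rewrite cover u v with toℕ u <ᵇ toℕ v | D u v in eq | D v u in eq′
    ... | false | _     | _     = refl
    ... | true  | false | false = refl
    ... | true  | false | true  = refl
    ... | true  | true  | false = refl
    ... | true  | true  | true  with () ← trans (sym eq′) (asym u v eq)

  -- The second branch is a default that yields an arc only when the pair is an edge; then `cover`
  -- leaves the opposite direction as the sole possibility.
  orient : Rel n → Arc → Arc
  orient D (u , v) = if D u v then (u , v) else (v , u)

  orient-∈ : ∀ {G D} → IsOrientation n G D → ∀ {u v} → G u v ≡ true → orient D (u , v) ∈ arcs D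
  orient-∈ {G} {D} or {u} {v} g with D u v in eq | trans (sym (IsOrientation.cover or u v)) g
  ... | true  | _ = ∈-arcs⁺ D eq
  ... | false | h = ∈-arcs⁺ D h

  endpoints-orient : ∀ D M → endpoints (map (orient D) M) ↭ endpoints M
  endpoints-orient D [] = ↭-refl
  endpoints-orient D ((u , v) ∷ M) with D u v
  ... | true  = prep u (prep v (endpoints-orient D M))
  ... | false = _↭_.swap v u (endpoints-orient D M)

  endpoints-↭ : ∀ {M N : List Arc} → M ↭ N → endpoints M ↭ endpoints N
  endpoints-↭ _↭_.refl = ↭-refl
  endpoints-↭ (prep (u , v) p) = prep u (prep v (endpoints-↭ p))
  endpoints-↭ (_↭_.swap (u , v) (x , y) p) =
    ↭-trans (Permₚ.shifts (u ∷ v ∷ []) (x ∷ y ∷ [])) (prep x (prep y (prep u (prep v (endpoints-↭ p)))))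
  endpoints-↭ (_↭_.trans p q) = ↭-trans (endpoints-↭ p) (endpoints-↭ q)

  tail∈endpoints : ∀ {M : List Arc} {e} → e ∈ M → proj₁ e ∈ endpoints M
  tail∈endpoints (here refl) = here refl
  tail∈endpoints (there e∈)  = there (there (tail∈endpoints e∈))

  head∈endpoints : ∀ {M : List Arc} {e} → e ∈ M → proj₂ e ∈ endpoints M
  head∈endpoints (here refl) = there (here refl)
  head∈endpoints (there e∈)  = there (there (head∈endpoints e∈))

  endpoints-separated : ∀ {M : List Arc} → Unique (endpoints M) → Separated M
  endpoints-separated {[]} _ = separated [] []
  endpoints-separated {(u , v) ∷ M} uu@(_ ∷ uv@(_ ∷ uM)) with separated t h ← endpoints-separated uM
    = separated (Unique-∷ u∉ t) (Unique-∷ v∉ h)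
    where
    u∉ : u ∉ map proj₁ M
    u∉ u∈ with f , f∈ , refl ← ∈-map⁻ proj₁ u∈ = Unique[x∷xs]⇒x∉xs uu (there (tail∈endpoints f∈))
    v∉ : v ∉ map proj₂ M
    v∉ v∈ with f , f∈ , refl ← ∈-map⁻ proj₂ v∈ = Unique[x∷xs]⇒x∉xs uv (head∈endpoints f∈)

-- The arcs of the model digraph

-- P is the first label of an attached path, and l = m - 3 is the number of these paths.
data ModelArc (P l : ℕ) : ℕ → ℕ → Set where
  toNear : ∀ {v} → 0 < v → v < P → ModelArc P l 0 v
  toPath : ∀ {i} → i < l → ModelArc P l 0 (P + 2 * i)
  tri₁   : ModelArc P l 1 2
  tri₂   : ModelArc P l 3 4
  leg    : ∀ {i} → i < l → ModelArc P l (suc (P + 2 * i)) (P + 2 * i)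

module Model (n m l : ℕ) (n≡ : n ≡ 5 + ((n ∸ 2 * m) + 1) + 2 * l) where

  private
    open Equivalence

    P : ℕ
    P = 5 + ((n ∸ 2 * m) + 1)

    T-not : ∀ {b} → T (not b) → T b → ⊥
    T-not {false} _ ()
    T-not {true} ()

    not-T : ∀ {b} → (T b → ⊥) → T (not b)
    not-T {false} _ = _
    not-T {true} h = h _

    half : ∀ {x r} → P ≤ x → (x ∸ P) % 2 ≡ r → x ≡ r + (P + 2 * ((x ∸ P) / 2))
    half {x} {r} P≤x eq = begin
      x                                            ≡⟨ sym (m+[n∸m]≡n P≤x) ⟩
      P + (x ∸ P)                                  ≡⟨ cong (P +_) (m≡m%n+[m/n]*n (x ∸ P) 2) ⟩
      P + ((x ∸ P) % 2 + (x ∸ P) / 2 * 2)          ≡⟨ cong (λ z → P + (z + (x ∸ P) / 2 * 2)) eq ⟩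
      P + (r + (x ∸ P) / 2 * 2)                    ≡⟨ alg P r ((x ∸ P) / 2) ⟩
      r + (P + 2 * ((x ∸ P) / 2)) ∎
      where
      open ≡-Reasoning
      alg : ∀ p r q → p + (r + q * 2) ≡ r + (p + 2 * q)
      alg = solve-∀

    index< : ∀ i r → r + (P + 2 * i) < n → i < l
    index< i r h = *-cancelˡ-< 2 i l
      (+-cancelˡ-< P (2 * i) (2 * l) (≤-trans (s≤s (m≤n+m _ r)) (subst (r + (P + 2 * i) <_) n≡ h)))

    odd<n : ∀ {i} → i < l → suc (P + 2 * i) < n
    odd<n {i} i<l = subst (suc (P + 2 * i) <_) (sym n≡) (≤-trans (≤-reflexive (alg P i)) (+-monoʳ-≤ P (*-monoʳ-≤ 2 i<l)))
      where
      alg : ∀ p i → suc (suc (p + 2 * i)) ≡ p + 2 * suc i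
      alg = solve-∀

    even%2 : ∀ i → (P + 2 * i ∸ P) % 2 ≡ 0
    even%2 i = trans (cong (_% 2) (trans (m+n∸m≡n P (2 * i)) (*-comm 2 i))) (m*n%n≡0 i 2)

    odd%2 : ∀ i → (suc (P + 2 * i) ∸ P) % 2 ≡ 1
    odd%2 i = trans (cong (_% 2) (trans (cong (_∸ P) (sym (+-suc P (2 * i))))
      (trans (m+n∸m≡n P (suc (2 * i))) (cong suc (*-comm 2 i))))) ([m+kn]%n≡m%n 1 i 2)

    ≮ᵇ : ∀ {x} → P ≤ x → T (not (x <ᵇ P))
    ≮ᵇ {x} h = not-T (λ t → <⇒≱ (<ᵇ⇒< x P t) h)

    ≮ᵇ⁻ : ∀ {x} → T (not (x <ᵇ P)) → P ≤ x
    ≮ᵇ⁻ t = ≮⇒≥ (λ lt → T-not t (<⇒<ᵇ lt))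

  -- The disjuncts of the Boolean formula are taken in turn. The index of a path is half the
  -- distance of its label from `P`, rounded down, and `n≡` converts the bound by `n` into a bound
  -- by `l`.
  fromB1arc : ∀ u v → T (B1arc n m u v) → ModelArc P l u v
  fromB1arc u v t with to (T-∨ {(u ≡ᵇ 0) ∧ (0 <ᵇ v) ∧ (v <ᵇ P)}) t
  ... | inj₁ c with a , b ← to (T-∧ {u ≡ᵇ 0}) c with b₁ , b₂ ← to (T-∧ {0 <ᵇ v}) b
    with refl ← ≡ᵇ⇒≡ u 0 a = toNear (<ᵇ⇒< 0 v b₁) (<ᵇ⇒< v P b₂)
  ... | inj₂ t with to (T-∨ {(u ≡ᵇ 0) ∧ not (v <ᵇ P) ∧ (v <ᵇ n) ∧ (((v ∸ P) % 2) ≡ᵇ 0)}) t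
  ... | inj₁ c with a , b ← to (T-∧ {u ≡ᵇ 0}) c with b₁ , c ← to (T-∧ {not (v <ᵇ P)}) b
    with b₂ , b₃ ← to (T-∧ {v <ᵇ n}) c
    with refl ← ≡ᵇ⇒≡ u 0 a with eq ← half (≮ᵇ⁻ {v} b₁) (≡ᵇ⇒≡ ((v ∸ P) % 2) 0 b₃)
    = subst (ModelArc P l 0) (sym eq) (toPath {i = (v ∸ P) / 2} (index< ((v ∸ P) / 2) 0 (subst (_< n) eq (<ᵇ⇒< v n b₂))))
  fromB1arc u v _ | _ | inj₂ t with to (T-∨ {(u ≡ᵇ 1) ∧ (v ≡ᵇ 2)}) t
  ... | inj₁ c with a , b ← to (T-∧ {u ≡ᵇ 1}) c with refl ← ≡ᵇ⇒≡ u 1 a | refl ← ≡ᵇ⇒≡ v 2 b = tri₁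
  ... | inj₂ t with to (T-∨ {(u ≡ᵇ 3) ∧ (v ≡ᵇ 4)}) t
  ... | inj₁ c with a , b ← to (T-∧ {u ≡ᵇ 3}) c with refl ← ≡ᵇ⇒≡ u 3 a | refl ← ≡ᵇ⇒≡ v 4 b = tri₂
  ... | inj₂ c with a , b ← to (T-∧ {not (u <ᵇ P)}) c with b₁ , c ← to (T-∧ {u <ᵇ n}) b
    with b₂ , b₃ ← to (T-∧ {((u ∸ P) % 2) ≡ᵇ 1}) c
    with eq ← half (≮ᵇ⁻ {u} a) (≡ᵇ⇒≡ ((u ∸ P) % 2) 1 b₂)
    = subst₂ (ModelArc P l) (sym eq) (suc-injective (trans (sym eq) (trans (sym (≡ᵇ⇒≡ (v + 1) u b₃)) (+-comm v 1))))
        (leg {i = (u ∸ P) / 2} (index< ((u ∸ P) / 2) 1 (subst (_< n) eq (<ᵇ⇒< u n b₁))))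

  toB1arc : ∀ {u v} → ModelArc P l u v → T (B1arc n m u v)
  toB1arc (toNear {v} 0<v v<P) = from T-∨ (inj₁ (from T-∧ (<⇒<ᵇ 0<v , <⇒<ᵇ v<P)))
  toB1arc (toPath {i} i<l) = from (T-∨ {(0 <ᵇ v) ∧ (v <ᵇ P)}) (inj₂
    (from (T-∨ {not (v <ᵇ P) ∧ (v <ᵇ n) ∧ (((v ∸ P) % 2) ≡ᵇ 0)})
      (inj₁ (from T-∧ (≮ᵇ (m≤m+n P (2 * i)) ,
        from T-∧ (<⇒<ᵇ (<-trans (n<1+n v) (odd<n i<l)) , ≡⇒≡ᵇ ((v ∸ P) % 2) 0 (even%2 i)))))))
    where
    v = P + 2 * i
  -- At these fixed labels the formula evaluates to `true` for all `n` and `m`.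
  toB1arc tri₁ = _
  toB1arc tri₂ = _
  toB1arc (leg {i} i<l) = from (T-∨ {(u ≡ᵇ 0) ∧ (0 <ᵇ v) ∧ (v <ᵇ P)}) (inj₂
    (from (T-∨ {(u ≡ᵇ 0) ∧ not (v <ᵇ P) ∧ (v <ᵇ n) ∧ (((v ∸ P) % 2) ≡ᵇ 0)})
      (inj₂ (from (T-∨ {(u ≡ᵇ 1) ∧ (v ≡ᵇ 2)}) (inj₂ (from (T-∨ {(u ≡ᵇ 3) ∧ (v ≡ᵇ 4)}) (inj₂
        (from T-∧ (≮ᵇ (m≤n⇒m≤1+n (m≤m+n P (2 * i))) , from T-∧ (<⇒<ᵇ (odd<n i<l) ,
          from T-∧ (≡⇒≡ᵇ ((u ∸ P) % 2) 1 (odd%2 i) , ≡⇒≡ᵇ (v + 1) u (+-comm v 1))))))))))))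
    where
    v = P + 2 * i
    u = suc v

-- A lower bound for the energy of the model

module EnergyLower {A : Set} (_≟_ : DecidableEquality A) where
  open Incidence _≟_

  energy-mono : ∀ {X L} → Unique X → (∀ {e} → e ∈ X → e ∈ L) → energy X ≤ energy L
  energy-mono {X} {L} u sub with Z , p ← Unique-⊆-complement u sub = begin
    energy X                                  ≤⟨ ≤-trans (m≤m+n (energy X) _) (m≤m+n _ (energy Z)) ⟩
    energy X + 2 * ∑ Z (deg X) + energy Z     ≡⟨ sym (energy-++ X Z) ⟩
    energy (X ++ Z)                           ≡⟨ sym (energy-↭ p) ⟩
    energy L ∎
    where open ≤-Reasoning

  -- Every arc of the star has degree at least `suc (length Y)` within it. An arc of `R` ends at a
  -- leaf, which gives 2 through the mixed term, and it gives another 2 with itself.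
  hub-energy≥ : ∀ c Y R → (∀ {e} → e ∈ R → proj₂ e ∈ Y) →
                length Y * suc (length Y) + 4 * length R ≤ energy (map (c ,_) Y ++ R)
  hub-energy≥ c Y R att = begin
    length Y * suc (length Y) + 4 * length R                          ≡⟨ alg (length Y * suc (length Y)) (length R) ⟩
    length Y * suc (length Y) + 2 * (length R * 1) + length R * 2
      ≤⟨ +-mono-≤ (+-mono-≤ star (*-monoʳ-≤ 2 (∑-≥const R 1 link))) (∑-≥const R 2 loop) ⟩
    energy S + 2 * ∑ R (deg S) + energy R                             ≡⟨ sym (energy-++ S R) ⟩
    energy (S ++ R) ∎
    where
    open ≤-Reasoning
    S : List Arc
    S = map (c ,_) Y
    alg : ∀ a r → a + 4 * r ≡ a + 2 * (r * 1) + r * 2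
    alg = solve-∀
    deg-S : ∀ e → deg S e ≡ length Y * δ (proj₁ e) c + ∑ Y (δ (proj₂ e))
    deg-S e = trans (∑-map (c ,_) Y (share e))
      (trans (∑-+ Y (λ _ → δ (proj₁ e) c) (δ (proj₂ e))) (cong (_+ ∑ Y (δ (proj₂ e))) (∑-const _ Y)))
    star : length Y * suc (length Y) ≤ energy S
    star = ≤-trans (∑-≥const Y _ (λ {y} y∈ → begin
      suc (length Y)                         ≡⟨ sym (trans (cong (_+ 1) (*-identityʳ _)) (+-comm _ 1)) ⟩
      length Y * 1 + 1                       ≤⟨ +-monoʳ-≤ _ (∑δ≥1 y∈) ⟩
      length Y * 1 + ∑ Y (δ y)               ≡⟨ cong (λ z → length Y * z + ∑ Y (δ y)) (sym (δ-refl c)) ⟩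
      length Y * δ c c + ∑ Y (δ y)           ≡⟨ sym (deg-S (c , y)) ⟩
      deg S (c , y) ∎)) (≤-reflexive (sym (∑-map (c ,_) Y (deg S))))
    link : ∀ {e} → e ∈ R → 1 ≤ deg S e
    link {e} e∈ = ≤-trans (∑δ≥1 (att e∈)) (≤-trans (m≤n+m _ (length Y * δ (proj₁ e) c)) (≤-reflexive (sym (deg-S e))))
    loop : ∀ {e} → e ∈ R → 2 ≤ deg R e
    loop {e} e∈ = ≤-trans (≤-reflexive (sym (share-refl e))) (∈⇒≤∑ {f = share e} e∈)

module ModelList (P′ l : ℕ) where

  open Incidence ℕₚ._≟_ using (energy)
  open EnergyLower ℕₚ._≟_

  private
    P : ℕ
    P = suc P′

  pathHead : ℕ → ℕ
  pathHead i = P + 2 * i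

  pathArc : ℕ → ℕ × ℕ
  pathArc i = suc (pathHead i) , pathHead i

  -- The out-neighbours of the centre 0. Since `P` is `suc P′`, the first piece runs through the
  -- labels from 1 to `P′`.
  nbrs : List ℕ
  nbrs = applyUpTo suc P′ ++ applyUpTo pathHead l

  rest : List (ℕ × ℕ)
  rest = (1 , 2) ∷ (3 , 4) ∷ applyUpTo pathArc l

  modelArcs : List (ℕ × ℕ)
  modelArcs = map (0 ,_) nbrs ++ rest

  ∈-rest : ∀ {e} → e ∈ rest → ModelArc P l (proj₁ e) (proj₂ e)
  ∈-rest (here refl)         = tri₁
  ∈-rest (there (here refl)) = tri₂
  ∈-rest (there (there e∈)) with i , i<l , refl ← ∈-applyUpTo⁻ pathArc e∈ = leg i<l

  ∈-nbrs : ∀ {v} → v ∈ nbrs → ModelArc P l 0 v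
  ∈-nbrs v∈ with ∈-++⁻ (applyUpTo suc P′) v∈
  ... | inj₁ v∈₁ with i , i<P′ , refl ← ∈-applyUpTo⁻ suc v∈₁ = toNear (s≤s z≤n) (s≤s i<P′)
  ... | inj₂ v∈₂ with i , i<l , refl ← ∈-applyUpTo⁻ pathHead v∈₂ = toPath i<l

  ∈-modelArcs : ∀ {e} → e ∈ modelArcs → ModelArc P l (proj₁ e) (proj₂ e)
  ∈-modelArcs e∈ with ∈-++⁻ (map (0 ,_) nbrs) e∈
  ... | inj₁ e∈₁ with v , v∈ , refl ← ∈-map⁻ (0 ,_) e∈₁ = ∈-nbrs v∈
  ... | inj₂ e∈₂ = ∈-rest e∈₂

  pathHead-mono : ∀ {i j} → i < j → pathHead i < pathHead j
  pathHead-mono i<j = +-monoʳ-< P (*-monoʳ-< 2 i<j)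

  nbrs-unique : Unique nbrs
  nbrs-unique = Uniqueₚ.++⁺ (Uniqueₚ.applyUpTo⁺₁ suc P′ (λ i<j _ eq → <⇒≢ i<j (suc-injective eq)))
    (Uniqueₚ.applyUpTo⁺₁ pathHead l (λ i<j _ → <⇒≢ (pathHead-mono i<j)))
    (λ (a , b) → disj a b)
    where
    disj : ∀ {v} → v ∈ applyUpTo suc P′ → v ∉ applyUpTo pathHead l
    disj v∈ v∈′ with i , i<P′ , refl ← ∈-applyUpTo⁻ suc v∈ | j , _ , eq ← ∈-applyUpTo⁻ pathHead v∈′ =
      <⇒≱ i<P′ (≤-trans (m≤m+n P′ (2 * j)) (≤-reflexive (sym (suc-injective eq))))

  module _ (P≥5 : 5 ≤ P) where

    rest-unique : Unique rest
    rest-unique = Unique-∷ (λ { (there e∈) → big e∈ (s≤s z≤n) })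
      (Unique-∷ (λ e∈ → big e∈ (s≤s (s≤s (s≤s z≤n))))
        (Uniqueₚ.applyUpTo⁺₁ pathArc l (λ i<j _ eq → <⇒≢ (pathHead-mono i<j) (cong proj₂ eq))))
      where
      big : ∀ {e} → e ∈ applyUpTo pathArc l → proj₁ e ≤ 3 → ⊥
      big e∈ h with i , _ , refl ← ∈-applyUpTo⁻ pathArc e∈ =
        <⇒≱ {3} (≤-trans (m≤n+m 4 1) (≤-trans P≥5 (≤-trans (m≤m+n P (2 * i)) (n≤1+n _)))) h

    attached : ∀ {e} → e ∈ rest → proj₂ e ∈ nbrs
    attached (here refl)         = ∈-++⁺ˡ (∈-applyUpTo⁺ suc (≤-trans (s≤s (s≤s z≤n)) (≤-pred P≥5)))
    attached (there (here refl)) = ∈-++⁺ˡ (∈-applyUpTo⁺ suc (≤-pred P≥5))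
    attached (there (there e∈)) with i , i<l , refl ← ∈-applyUpTo⁻ pathArc e∈ =
      ∈-++⁺ʳ (applyUpTo suc P′) (∈-applyUpTo⁺ pathHead i<l)

    tail≢0 : ∀ {e} → e ∈ rest → proj₁ e ≢ 0
    tail≢0 (here refl) ()
    tail≢0 (there (here refl)) ()
    tail≢0 (there (there e∈)) eq with i , _ , refl ← ∈-applyUpTo⁻ pathArc e∈ with () ← eq

    modelArcs-unique : Unique modelArcs
    modelArcs-unique = Uniqueₚ.++⁺ (Uniqueₚ.map⁺ (λ { refl → refl }) nbrs-unique) rest-unique (λ (a , b) → disj a b)
      where
      disj : ∀ {e} → e ∈ map (0 ,_) nbrs → e ∉ rest
      disj a b with _ , _ , refl ← ∈-map⁻ (0 ,_) a = tail≢0 b refl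

    energy-modelArcs : (P′ + l) * suc (P′ + l) + 4 * (2 + l) ≤ energy modelArcs
    energy-modelArcs = subst₂ (λ y r → y * suc y + 4 * (2 + r) ≤ energy modelArcs)
      (trans (length-++ (applyUpTo suc P′)) (cong₂ _+_ (length-applyUpTo suc P′) (length-applyUpTo pathHead l)))
      (length-applyUpTo pathArc l)
      (hub-energy≥ 0 nbrs rest attached)

ModelArc-bounded : ∀ {P l u v} → 5 ≤ P → ModelArc P l u v → (u < P + 2 * l) × (v < P + 2 * l)
ModelArc-bounded {P} {l} P≥5 = go
  where
  small : ∀ {x} → x < P → x < P + 2 * l
  small h = ≤-trans h (m≤m+n P (2 * l))
  path : ∀ {i} → i < l → suc (P + 2 * i) < P + 2 * l
  path {i} i<l = ≤-trans (≤-reflexive (alg P i)) (+-monoʳ-≤ P (*-monoʳ-≤ 2 i<l))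
    where
    alg : ∀ p i → suc (suc (p + 2 * i)) ≡ p + 2 * suc i
    alg = solve-∀
  go : ∀ {u v} → ModelArc P l u v → (u < P + 2 * l) × (v < P + 2 * l)
  go (toNear _ v<P) = small (≤-trans (s≤s z≤n) P≥5) , small v<P
  go (toPath i<l)   = small (≤-trans (s≤s z≤n) P≥5) , <-trans (n<1+n _) (path i<l)
  go tri₁           = small (≤-trans (s≤s (s≤s z≤n)) P≥5) , small (≤-trans (s≤s (s≤s (s≤s z≤n))) P≥5)
  go tri₂           = small (≤-trans (n≤1+n 4) P≥5) , small P≥5
  go (leg i<l)      = path i<l , <-trans (n<1+n _) (path i<l)

module FromModel (n m l : ℕ) (n≡ : n ≡ 5 + ((n ∸ 2 * m) + 1) + 2 * l) where

  private
    P′ : ℕ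
    P′ = 4 + ((n ∸ 2 * m) + 1)

  open FinArcs n
  open ModelList P′ l
  open Model n m l n≡
  open EnergyLower ℕₚ._≟_
  module ℕ-Arcs = Incidence ℕₚ._≟_

  -- Energy depends only on which ends coincide, so an injective relabelling preserves it; the
  -- relabelled arcs of `D` include all arcs of the model.
  ≅B1⇒energy≥ : ∀ {D} → D ≅ B1 n m → (P′ + l) * suc (P′ + l) + 4 * (2 + l) ≤ energy (arcs D)
  ≅B1⇒energy≥ {D} (f , (inj , surj) , hom) = begin
    (P′ + l) * suc (P′ + l) + 4 * (2 + l)   ≤⟨ energy-modelArcs P≥5 ⟩
    ℕ-Arcs.energy modelArcs                 ≤⟨ energy-mono (modelArcs-unique P≥5) (λ e∈ → image (∈-modelArcs e∈)) ⟩
    ℕ-Arcs.energy (map label (arcs D))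
      ≡⟨ trans (∑-map label (arcs D) _) (∑-cong (arcs D) λ e → trans (∑-map label (arcs D) _) (∑-cong (arcs D) (share-label e))) ⟩
    energy (arcs D) ∎
    where
    open ≤-Reasoning
    P≥5 : 5 ≤ suc P′
    P≥5 = s≤s (m≤m+n 4 _)
    label : Arc → ℕ × ℕ
    label (u , v) = toℕ (f u) , toℕ (f v)
    δ-label : ∀ x y → ℕ-Arcs.δ (toℕ (f x)) (toℕ (f y)) ≡ δ x y
    δ-label x y with x Finₚ.≟ y
    ... | yes refl = ℕ-Arcs.δ-refl (toℕ (f x))
    ... | no ne    = ℕ-Arcs.δ-≢ (λ eq → ne (inj (toℕ-injective eq)))
    share-label : ∀ e e′ → ℕ-Arcs.share (label e) (label e′) ≡ share e e′
    share-label e e′ = cong₂ _+_ (δ-label _ _) (δ-label _ _)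
    preimage : ∀ {i} → i < suc P′ + 2 * l → ∃ λ x → toℕ (f x) ≡ i
    preimage i< = proj₁ (surj i′) , trans (cong toℕ (proj₂ (surj i′) refl)) (toℕ-fromℕ< _)
      where i′ = fromℕ< (subst (_ <_) (sym n≡) i<)
    image : ∀ {u v} → ModelArc (suc P′) l u v → (u , v) ∈ map label (arcs D)
    image arc with preimage (proj₁ (ModelArc-bounded P≥5 arc)) | preimage (proj₂ (ModelArc-bounded P≥5 arc))
    ... | x , refl | y , refl = ∈-map⁺ label (∈-arcs⁺ D (trans (hom x y) (Equivalence.to T-≡ (toB1arc arc))))

-- Positions in lists

module _ {A : Set} where

  -- Lookup as a relation: in a duplicate-free list position and entry determine each other, so
  -- positions can serve as vertex labels.
  data At : List A → ℕ → A → Set where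
    here  : ∀ {x xs} → At (x ∷ xs) 0 x
    there : ∀ {x y xs i} → At xs i x → At (y ∷ xs) (suc i) x

  At-functional : ∀ {xs i x y} → At xs i x → At xs i y → x ≡ y
  At-functional here      here      = refl
  At-functional (there p) (there q) = At-functional p q

  At⇒∈ : ∀ {xs i x} → At xs i x → x ∈ xs
  At⇒∈ here      = here refl
  At⇒∈ (there p) = there (At⇒∈ p)

  At-injective : ∀ {xs i j x} → Unique xs → At xs i x → At xs j x → i ≡ j
  At-injective _ here here = refl
  At-injective u here (there q) = ⊥-elim (Unique[x∷xs]⇒x∉xs u (At⇒∈ q))
  At-injective u (there p) here = ⊥-elim (Unique[x∷xs]⇒x∉xs u (At⇒∈ p))
  At-injective (_ ∷ u) (there p) (there q) = cong suc (At-injective u p q)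

  At⇒< : ∀ {xs i x} → At xs i x → i < length xs
  At⇒< here      = s≤s z≤n
  At⇒< (there p) = s≤s (At⇒< p)

  ∈⇒At : ∀ {xs x} → x ∈ xs → ∃ λ i → At xs i x
  ∈⇒At (here refl) = 0 , here
  ∈⇒At (there x∈) with i , p ← ∈⇒At x∈ = suc i , there p

  <⇒At : ∀ {xs i} → i < length xs → ∃ λ x → At xs i x
  <⇒At {x ∷ xs} {zero} _ = x , here
  <⇒At {x ∷ xs} {suc i} (s≤s h) with y , p ← <⇒At h = y , there p

  At-++⁺ˡ : ∀ {xs ys i x} → At xs i x → At (xs ++ ys) i x
  At-++⁺ˡ here      = here
  At-++⁺ˡ (there p) = there (At-++⁺ˡ p)

  At-++⁺ʳ : ∀ xs {ys i x} → At ys i x → At (xs ++ ys) (length xs + i) x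
  At-++⁺ʳ []       p = p
  At-++⁺ʳ (x ∷ xs) p = there (At-++⁺ʳ xs p)

  At-++⁻ˡ : ∀ xs {ys i x} → i < length xs → At (xs ++ ys) i x → At xs i x
  At-++⁻ˡ (x ∷ xs) _       here      = here
  At-++⁻ˡ (x ∷ xs) (s≤s h) (there p) = there (At-++⁻ˡ xs h p)

module _ {A : Set} where

  -- The order of the labels P + 2j, P + 2j + 1 in B1: the middle vertex of a path precedes its end.
  legs : List (A × A) → List A
  legs []             = []
  legs ((w , v) ∷ es) = v ∷ w ∷ legs es

  legs-↭ : ∀ es → legs es ↭ map proj₂ es ++ map proj₁ es
  legs-↭ [] = ↭-refl
  legs-↭ ((w , v) ∷ es) = prep v (↭-trans (prep w (legs-↭ es)) (↭-sym (shift w (map proj₂ es) (map proj₁ es))))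

  At-legs : ∀ {es i w v} → At es i (w , v) → At (legs es) (2 * i) v × At (legs es) (suc (2 * i)) w
  At-legs here = here , there here
  At-legs {e ∷ es} {suc i} {w} {v} (there p) with q , r ← At-legs p =
      subst (λ z → At (legs (e ∷ es)) z v) (sym (*-suc 2 i)) (there (there q))
    , subst (λ z → At (legs (e ∷ es)) z w) (cong suc (sym (*-suc 2 i))) (there (there r))

  split : ∀ {P : A → Set} → Decidable P → ∀ xs → ∃ λ ys → ∃ λ zs →
          xs ↭ ys ++ zs × (∀ {x} → x ∈ ys → P x) × (∀ {x} → x ∈ zs → ¬ P x)
  split P? [] = [] , [] , ↭-refl , (λ ()) , (λ ())
  split P? (x ∷ xs) with ys , zs , p , all , none ← split P? xs | P? x
  ... | yes h = x ∷ ys , zs , prep x p , (λ { (here refl) → h ; (there y∈) → all y∈ }) , none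
  ... | no ¬h = ys , x ∷ zs , ↭-trans (prep x p) (↭-sym (shift x ys zs)) , all , (λ { (here refl) → ¬h ; (there y∈) → none y∈ })

endpoints-++ : ∀ {n} (es fs : List (Fin n × Fin n)) → endpoints (es ++ fs) ≡ endpoints es ++ endpoints fs
endpoints-++ [] fs = refl
endpoints-++ ((u , v) ∷ es) fs = cong (λ z → u ∷ v ∷ z) (endpoints-++ es fs)

∈-endpoints⁻ : ∀ {n} {es : List (Fin n × Fin n)} {x} → x ∈ endpoints es → (x ∈ map proj₁ es) ⊎ (x ∈ map proj₂ es)
∈-endpoints⁻ {es = _ ∷ _} (here refl) = inj₁ (here refl)
∈-endpoints⁻ {es = _ ∷ _} (there (here refl)) = inj₂ (here refl)
∈-endpoints⁻ {es = _ ∷ _} (there (there x∈)) with ∈-endpoints⁻ x∈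
... | inj₁ h = inj₁ (there h)
... | inj₂ h = inj₂ (there h)

length-endpoints : ∀ {n} (es : List (Fin n × Fin n)) → length (endpoints es) ≡ 2 * length es
length-endpoints []       = refl
length-endpoints (_ ∷ es) = trans (cong (2 +_) (length-endpoints es)) (sym (*-suc 2 (length es)))

At-endpoints : ∀ {n} {es : List (Fin n × Fin n)} {i w v} → At es i (w , v) →
               At (endpoints es) (2 * i) w × At (endpoints es) (suc (2 * i)) v
At-endpoints here = here , there here
At-endpoints {es = e ∷ es} {suc i} {w} {v} (there p) with q , r ← At-endpoints p =
    subst (λ z → At (endpoints (e ∷ es)) z w) (sym (*-suc 2 i)) (there (there q))
  , subst (λ z → At (endpoints (e ∷ es)) z v) (cong suc (sym (*-suc 2 i))) (there (there r))

true-ext : ∀ {b c : Bool} → (b ≡ true → c ≡ true) → (c ≡ true → b ≡ true) → b ≡ c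
true-ext {false} {false} f g = refl
true-ext {false} {true}  f g = g refl
true-ext {true}          f g = sym (f refl)

-- The isomorphism onto the model

module ToModel {n m l : ℕ} (n≡ : n ≡ 5 + ((n ∸ 2 * m) + 1) + 2 * l) (D : Rel n)
  {a : Fin n} {Y : List (Fin n)} {R : List (Fin n × Fin n)}
  (arc⁻ : ∀ {u v} → D u v ≡ true → (u ≡ a × v ∈ Y) ⊎ ((u , v) ∈ R))
  (arc-Y : ∀ {v} → v ∈ Y → D a v ≡ true)
  (arc-R : ∀ {u v} → (u , v) ∈ R → D u v ≡ true)
  (uY : Unique (a ∷ Y)) (uR : Unique (a ∷ endpoints R))
  (attached : ∀ {e} → e ∈ R → proj₂ e ∈ Y)
  (spanning : ∀ z → (z ≡ a) ⊎ (z ∈ Y) ⊎ (z ∈ endpoints R))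
  (|Y| : length Y ≡ 5 + (n ∸ 2 * m) + l) (|R| : length R ≡ 2 + l)
  where

  open FinArcs n
  open Model n m l n≡
  open import Data.List.Membership.DecPropositional (Finₚ._≟_ {n}) using (_∈?_)

  private
    r : ℕ
    r = n ∸ 2 * m

  -- T: the edges closing a triangle; Q: the outer edges of the attached paths.
  module _ {T Q : List Arc} (R↭ : R ↭ T ++ Q)
           (T-near : ∀ {e} → e ∈ T → proj₁ e ∈ Y) (Q-far : ∀ {e} → e ∈ Q → proj₁ e ∉ Y) where

    uTQ : Unique (endpoints T ++ endpoints Q)
    uTQ = Unique-resp-↭ (↭-trans (endpoints-↭ R↭) (↭-reflexive (endpoints-++ T Q))) (Unique-++⁻ʳ (a ∷ []) uR)

    uT : Unique (endpoints T)
    uT = Unique-++⁻ˡ (endpoints T) uTQ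

    sepQ : Separated Q
    sepQ = endpoints-separated (Unique-++⁻ʳ (endpoints T) uTQ)

    T⊆R : ∀ {e} → e ∈ T → e ∈ R
    T⊆R e∈ = ∈-resp-↭ (↭-sym R↭) (∈-++⁺ˡ e∈)

    Q⊆R : ∀ {e} → e ∈ Q → e ∈ R
    Q⊆R e∈ = ∈-resp-↭ (↭-sym R↭) (∈-++⁺ʳ T e∈)

    endsT⊆Y : ∀ {x} → x ∈ endpoints T → x ∈ Y
    endsT⊆Y x∈ with ∈-endpoints⁻ x∈
    ... | inj₁ h with e , e∈ , refl ← ∈-map⁻ proj₁ h = T-near e∈
    ... | inj₂ h with e , e∈ , refl ← ∈-map⁻ proj₂ h = attached (T⊆R e∈)

    headsQ⊆Y : ∀ {x} → x ∈ map proj₂ Q → x ∈ Y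
    headsQ⊆Y h with e , e∈ , refl ← ∈-map⁻ proj₂ h = attached (Q⊆R e∈)

    -- The members of `Y` that lie on an arc of `R`: the four triangle vertices, once `T` is known
    -- to have two arcs, and the middle vertices of the paths. The rest of `Y` are the pendent
    -- vertices.
    W : List (Fin n)
    W = endpoints T ++ map proj₂ Q

    uW : Unique W
    uW = Uniqueₚ.++⁺ uT (Separated.heads sepQ) (λ (x∈T , x∈Q) → disj x∈T x∈Q)
      where
      disj : ∀ {x} → x ∈ endpoints T → x ∉ map proj₂ Q
      disj x∈T x∈Q with e , e∈ , refl ← ∈-map⁻ proj₂ x∈Q = Unique-++⁻-disjoint (endpoints T) uTQ x∈T (head∈endpoints e∈)

    W⊆Y : ∀ {x} → x ∈ W → x ∈ Y
    W⊆Y x∈ with ∈-++⁻ (endpoints T) x∈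
    ... | inj₁ h = endsT⊆Y h
    ... | inj₂ h = headsQ⊆Y h

    module _ {pendents : List (Fin n)} (Y↭ : Y ↭ W ++ pendents) where

      near : List (Fin n)
      near = endpoints T ++ pendents

      -- The order is that of the labels in `B1`: centre, triangle vertices, pendent vertices, then
      -- each path with its middle vertex first. The position of a vertex is thus its label.
      vertices : List (Fin n)
      vertices = a ∷ near ++ legs Q

      vertices-↭ : vertices ↭ a ∷ Y ++ map proj₁ Q
      vertices-↭ = prep a (begin
        (eT ++ pendents) ++ legs Q            ↭⟨ Permₚ.++⁺ˡ (eT ++ pendents) (legs-↭ Q) ⟩
        (eT ++ pendents) ++ (hQ ++ tQ)        ≡⟨ sym (++-assoc (eT ++ pendents) hQ tQ) ⟩
        ((eT ++ pendents) ++ hQ) ++ tQ        ↭⟨ Permₚ.++⁺ʳ tQ mid ⟩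
        ((eT ++ hQ) ++ pendents) ++ tQ        ↭⟨ Permₚ.++⁺ʳ tQ (↭-sym Y↭) ⟩
        Y ++ tQ ∎)
        where
        open PermutationReasoning
        eT hQ tQ : List (Fin n)
        eT = endpoints T
        hQ = map proj₂ Q
        tQ = map proj₁ Q
        mid : (eT ++ pendents) ++ hQ ↭ (eT ++ hQ) ++ pendents
        mid = begin
          (eT ++ pendents) ++ hQ   ≡⟨ ++-assoc eT pendents hQ ⟩
          eT ++ (pendents ++ hQ)   ↭⟨ Permₚ.++⁺ˡ eT (Permₚ.++-comm pendents hQ) ⟩
          eT ++ (hQ ++ pendents)   ≡⟨ sym (++-assoc eT hQ pendents) ⟩
          (eT ++ hQ) ++ pendents ∎

      vertices-unique : Unique vertices
      vertices-unique = Unique-resp-↭ (↭-sym vertices-↭)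
        (Unique-∷ a∉ (Uniqueₚ.++⁺ (Unique-++⁻ʳ (a ∷ []) uY) (Separated.tails sepQ) (λ (x∈Y , x∈Q) → far x∈Q x∈Y)))
        where
        far : ∀ {x} → x ∈ map proj₁ Q → x ∉ Y
        far x∈ with e , e∈ , refl ← ∈-map⁻ proj₁ x∈ = Q-far e∈
        a∉ : a ∉ Y ++ map proj₁ Q
        a∉ a∈ with ∈-++⁻ Y a∈
        ... | inj₁ h = Unique[x∷xs]⇒x∉xs uY h
        ... | inj₂ h with e , e∈ , refl ← ∈-map⁻ proj₁ h = Unique[x∷xs]⇒x∉xs uR (tail∈endpoints (Q⊆R e∈))

      vertices-complete : ∀ z → z ∈ vertices
      vertices-complete z = ∈-resp-↭ (↭-sym vertices-↭) (locate (spanning z))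
        where
        onTail : ∀ {e} → e ∈ T ++ Q → proj₁ e ∈ Y ++ map proj₁ Q
        onTail e∈ with ∈-++⁻ T e∈
        ... | inj₁ h = ∈-++⁺ˡ (T-near h)
        ... | inj₂ h = ∈-++⁺ʳ Y (∈-map⁺ proj₁ h)
        locate : (z ≡ a) ⊎ (z ∈ Y) ⊎ (z ∈ endpoints R) → z ∈ a ∷ Y ++ map proj₁ Q
        locate (inj₁ refl) = here refl
        locate (inj₂ (inj₁ h)) = there (∈-++⁺ˡ h)
        locate (inj₂ (inj₂ h)) with ∈-endpoints⁻ h
        ... | inj₁ t with e , e∈ , refl ← ∈-map⁻ proj₁ t = there (onTail (∈-resp-↭ R↭ e∈))
        ... | inj₂ t with e , e∈ , refl ← ∈-map⁻ proj₂ t = there (∈-++⁺ˡ (attached e∈))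

      |vertices| : length vertices ≡ n
      |vertices| = ≤-antisym
        (≤-trans (Unique-⊆-length vertices-unique (λ {x} _ → ∈-allFin x)) (≤-reflexive (length-tabulate _)))
        (≤-trans (≤-reflexive (sym (length-tabulate _))) (Unique-⊆-length (Uniqueₚ.allFin⁺ n) (λ {x} _ → vertices-complete x)))

      -- The vertices are the centre, `Y` and the tails of `Q`, so counting them determines the
      -- number of paths. Since `R` has `2 + l` arcs, exactly two remain to close triangles.
      |Q| : length Q ≡ l
      |Q| = +-cancelˡ-≡ (6 + r + l) (length Q) l (begin
        6 + r + l + length Q             ≡⟨ cong₂ (λ y q → suc (y + q)) (sym |Y|) (sym (length-map proj₁ Q)) ⟩
        suc (length Y + length (map proj₁ Q)) ≡⟨ cong suc (sym (length-++ Y)) ⟩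
        length (a ∷ Y ++ map proj₁ Q)    ≡⟨ sym (↭-length vertices-↭) ⟩
        length vertices                  ≡⟨ |vertices| ⟩
        n                                ≡⟨ n≡ ⟩
        5 + (r + 1) + 2 * l              ≡⟨ alg r l ⟩
        6 + r + l + l ∎)
        where
        open ≡-Reasoning
        alg : ∀ r l → 5 + (r + 1) + 2 * l ≡ 6 + r + l + l
        alg = solve-∀

      |T| : length T ≡ 2
      |T| = +-cancelʳ-≡ l (length T) 2
        (trans (cong (length T +_) (sym |Q|)) (trans (sym (length-++ T)) (trans (sym (↭-length R↭)) |R|)))

      |pendents| : length pendents ≡ r + 1
      |pendents| = +-cancelˡ-≡ (4 + l) _ _ (begin
        4 + l + length pendents                  ≡⟨ cong (_+ length pendents) (sym |W|) ⟩
        length W + length pendents               ≡⟨ sym (length-++ W) ⟩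
        length (W ++ pendents)                   ≡⟨ sym (↭-length Y↭) ⟩
        length Y                                 ≡⟨ |Y| ⟩
        5 + r + l                                ≡⟨ alg r l ⟩
        4 + l + (r + 1) ∎)
        where
        open ≡-Reasoning
        |W| : length W ≡ 4 + l
        |W| = trans (length-++ (endpoints T)) (cong₂ _+_ (trans (length-endpoints T) (cong (2 *_) |T|))
          (trans (length-map proj₂ Q) |Q|))
        alg : ∀ r l → 5 + r + l ≡ 4 + l + (r + 1)
        alg = solve-∀

      |near| : length near ≡ 4 + (r + 1)
      |near| = trans (length-++ (endpoints T)) (cong₂ _+_ (trans (length-endpoints T) (cong (2 *_) |T|)) |pendents|)

      P : ℕ
      P = 5 + (r + 1)

      At-near : ∀ {i x} → At near i x → At vertices (suc i) x
      At-near p = there (At-++⁺ˡ p)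

      At-T : ∀ {i w v} → At T i (w , v) → At vertices (suc (2 * i)) w × At vertices (2 + 2 * i) v
      At-T p with q , q′ ← At-endpoints p = At-near (At-++⁺ˡ q) , At-near (At-++⁺ˡ q′)

      At-Q : ∀ {i w v} → At Q i (w , v) → At vertices (suc (P + 2 * i)) w × At vertices (P + 2 * i) v
      At-Q {i} {w} {v} p with q , q′ ← At-legs p
        = subst (λ z → At vertices z w)
            (cong suc (trans (+-suc (length near) (2 * i)) (cong (λ z → suc (z + 2 * i)) |near|))) (there (At-++⁺ʳ near q′))
        , subst (λ z → At vertices z v) (cong (λ z → suc (z + 2 * i)) |near|) (there (At-++⁺ʳ near q))

      Positioned : Fin n → Fin n → Set
      Positioned u v = ∃ λ i → ∃ λ j → At vertices i u × At vertices j v × ModelArc P l i j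

      near⇒model : ∀ {v} → v ∈ near → Positioned a v
      near⇒model v∈ with i , p ← ∈⇒At v∈ = 0 , suc i , here , At-near p ,
        toNear (s≤s z≤n) (s≤s (≤-trans (At⇒< p) (≤-reflexive |near|)))

      Y⇒model : ∀ {v} → v ∈ Y → Positioned a v
      Y⇒model v∈ with ∈-++⁻ W (∈-resp-↭ Y↭ v∈)
      ... | inj₂ h = near⇒model (∈-++⁺ʳ (endpoints T) h)
      ... | inj₁ v∈W with ∈-++⁻ (endpoints T) v∈W
      ... | inj₁ h = near⇒model (∈-++⁺ˡ h)
      ... | inj₂ h with e , e∈ , refl ← ∈-map⁻ proj₂ h with i , p ← ∈⇒At e∈ =
        0 , P + 2 * i , here , proj₂ (At-Q p) , toPath (≤-trans (At⇒< p) (≤-reflexive |Q|))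

      R⇒model : ∀ {u v} → (u , v) ∈ R → Positioned u v
      R⇒model uv∈ with ∈-++⁻ T (∈-resp-↭ R↭ uv∈)
      ... | inj₂ h with i , p ← ∈⇒At h =
        suc (P + 2 * i) , P + 2 * i , proj₁ (At-Q p) , proj₂ (At-Q p) , leg (≤-trans (At⇒< p) (≤-reflexive |Q|))
      ... | inj₁ h with ∈⇒At h
      ... | 0 , p = 1 , 2 , proj₁ (At-T p) , proj₂ (At-T p) , tri₁
      ... | 1 , p = 3 , 4 , proj₁ (At-T p) , proj₂ (At-T p) , tri₂
      ... | suc (suc i) , p with s≤s (s≤s ()) ← ≤-trans (At⇒< p) (≤-reflexive |T|)

      near⊆Y : ∀ {v} → v ∈ near → v ∈ Y
      near⊆Y v∈ with ∈-++⁻ (endpoints T) v∈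
      ... | inj₁ h = endsT⊆Y h
      ... | inj₂ h = ∈-resp-↭ (↭-sym Y↭) (∈-++⁺ʳ W h)

      arc-at : ∀ {i j u v w x} → D w x ≡ true → At vertices i w → At vertices j x →
               At vertices i u → At vertices j v → D u v ≡ true
      arc-at d p q p′ q′ = subst₂ (λ u v → D u v ≡ true) (At-functional p p′) (At-functional q q′) d

      -- For arcs outside the star, the index selects an arc of `T` or `Q`; its ends occupy the
      -- given positions and hence are the given vertices.
      model⇒arc : ∀ {i j u v} → ModelArc P l i j → At vertices i u → At vertices j v → D u v ≡ true
      model⇒arc (toNear _ (s≤s j<)) here (there q) =
        arc-Y (near⊆Y (At⇒∈ (At-++⁻ˡ near (≤-trans j< (≤-reflexive (sym |near|))) q)))
      model⇒arc (toPath i<l) = let _ , t = <⇒At {xs = Q} (≤-trans i<l (≤-reflexive (sym |Q|)))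
        in arc-at (arc-Y (attached (Q⊆R (At⇒∈ t)))) here (proj₂ (At-Q t))
      model⇒arc tri₁ = let _ , t = <⇒At {xs = T} {i = 0} (≤-trans (s≤s z≤n) (≤-reflexive (sym |T|)))
        in arc-at (arc-R (T⊆R (At⇒∈ t))) (proj₁ (At-T t)) (proj₂ (At-T t))
      model⇒arc tri₂ = let _ , t = <⇒At {xs = T} {i = 1} (≤-reflexive (sym |T|))
        in arc-at (arc-R (T⊆R (At⇒∈ t))) (proj₁ (At-T t)) (proj₂ (At-T t))
      model⇒arc (leg i<l) = let _ , t = <⇒At {xs = Q} (≤-trans i<l (≤-reflexive (sym |Q|)))
        in arc-at (arc-R (Q⊆R (At⇒∈ t))) (proj₁ (At-Q t)) (proj₂ (At-Q t))

      -- Every arc occupies the positions of some model arc, and these are the given ones because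
      -- `vertices` has no repetition.
      arc⇒model : ∀ {i j u v} → D u v ≡ true → At vertices i u → At vertices j v → ModelArc P l i j
      arc⇒model {i} {j} {u} {v} d p q = unique-position (locate (arc⁻ d))
        where
        locate : (u ≡ a × v ∈ Y) ⊎ ((u , v) ∈ R) → Positioned u v
        locate (inj₁ (refl , v∈)) = Y⇒model v∈
        locate (inj₂ uv∈)         = R⇒model uv∈
        unique-position : Positioned u v → ModelArc P l i j
        unique-position (_ , _ , p′ , q′ , arc) =
          subst₂ (ModelArc P l) (At-injective vertices-unique p′ p) (At-injective vertices-unique q′ q) arc

      position : ∀ x → ∃ λ i → At vertices i x
      position x = ∈⇒At (vertices-complete x)

      label : Fin n → Fin n
      label x = fromℕ< (≤-trans (At⇒< (proj₂ (position x))) (≤-reflexive |vertices|))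

      At-label : ∀ x → At vertices (toℕ (label x)) x
      At-label x = subst (λ i → At vertices i x) (sym (toℕ-fromℕ< _)) (proj₂ (position x))

      isomorphic : D ≅ B1 n m
      isomorphic = label , (injective , surjective) , λ u v → true-ext
        (λ d → Equivalence.to T-≡ (toB1arc (arc⇒model d (At-label u) (At-label v))))
        (λ b → model⇒arc (fromB1arc _ _ (Equivalence.from T-≡ b)) (At-label u) (At-label v))
        where
        injective : ∀ {x y} → label x ≡ label y → x ≡ y
        injective {x} {y} eq = At-functional (At-label x) (subst (λ i → At vertices (toℕ i) y) (sym eq) (At-label y))
        surjective : ∀ i → ∃ λ x → ∀ {z} → z ≡ x → label z ≡ i
        surjective i = let x , p = <⇒At {xs = vertices} (≤-trans (toℕ<n i) (≤-reflexive (sym |vertices|)))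
          in x , λ { refl → toℕ-injective (At-injective vertices-unique (At-label x) p) }

  ≅B1 : D ≅ B1 n m
  ≅B1 with T , Q , R↭ , T-near , Q-far ← split (λ e → proj₁ e ∈? Y) R
    with pendents , Y↭ ← Unique-⊆-complement (uW R↭ T-near Q-far) (W⊆Y R↭ T-near Q-far)
    = isomorphic R↭ T-near Q-far Y↭

-- The hypothesis gives `2 * (3 + l) ≤ n`, so the truncated subtraction is exact.
half-range : ∀ {n l} → 3 + l ≤ n / 2 → n ≡ 5 + ((n ∸ 2 * (3 + l)) + 1) + 2 * l
half-range {n} {l} h = trans (sym (m+[n∸m]≡n 2m≤n)) (alg l (n ∸ 2 * (3 + l)))
  where
  2m≤n : 2 * (3 + l) ≤ n
  2m≤n = ≤-trans (≤-reflexive (*-comm 2 (3 + l))) (≤-trans (*-monoˡ-≤ 2 h) (m/n*n≤m n 2))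
  alg : ∀ l r → 2 * (3 + l) + r ≡ 5 + (r + 1) + 2 * l
  alg = solve-∀

-- Reversal of arcs and the bicyclic case

reverse : ∀ {n} → Rel n → Rel n
reverse D u v = D v u

reverse-orientation : ∀ {n G D} → IsOrientation n G D → IsOrientation n G (reverse D)
reverse-orientation {D = D} or = record
  { cover = λ u v → trans (cover u v) (∨-comm (D u v) (D v u))
  ; asym  = λ u v → asym v u }
  where open IsOrientation or

reverse-≅B1 : ∀ {n m} {D : Rel n} → reverse D ≅ B1 n m → D ≅ B2 n m
reverse-≅B1 (f , bij , hom) = f , bij , λ u v → hom v u

≅B2⇒reverse-≅B1 : ∀ {n m} {D : Rel n} → D ≅ B2 n m → reverse D ≅ B1 n m
≅B2⇒reverse-≅B1 (f , bij , hom) = f , bij , λ u v → hom v u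

twiceM1-reverse : ∀ {n} (D : Rel n) → twiceM1 (reverse D) ≡ twiceM1 D
twiceM1-reverse {n} D = ∑-cong (allFin n) (λ u → +-comm (indeg D u * indeg D u) (outdeg D u * outdeg D u))

module Bicyclics {n l : ℕ} (n≡ : n ≡ 5 + ((n ∸ 2 * (3 + l)) + 1) + 2 * l)
                 {G : Rel n} (connected : Connected G) where

  private
    m r : ℕ
    m = 3 + l
    r = n ∸ 2 * m

  open FinArcs n
  open Extremal (Finₚ._≟_ {n})
  open Equality (Finₚ._≟_ {n})

  -- `M` is the oriented matching and `N` the list of the other arcs. The field `ends` retains that
  -- `M` is a matching of the graph itself: it yields `Separated`, and later it keeps the vertices
  -- of triangles and paths distinct.
  record Decomposition (D : Rel n) (M N : List Arc) : Set where
    field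
      arcs⁺     : ∀ {u v} → D u v ≡ true → (u , v) ∈ M ++ N
      arcs⁻     : ∀ {u v} → (u , v) ∈ M ++ N → D u v ≡ true
      unique    : Unique (M ++ N)
      ends      : Unique (endpoints M)
      |M|       : length M ≡ m
      |N|       : length N ≡ 4 + r + l

  reverse-decomposition : ∀ {D M N} → Decomposition D M N → Decomposition (reverse D) (map swap M) (map swap N)
  reverse-decomposition {D} {M} {N} dec = record
    { arcs⁺  = λ d → subst (_ ∈_) (map-++ swap M N) (∈-map⁺ swap (arcs⁺ d))
    ; arcs⁻  = λ {u} {v} uv∈ → from (∈-map⁻ swap (subst ((u , v) ∈_) (sym (map-++ swap M N)) uv∈))
    ; unique = map-swap-unique M unique
    ; ends   = Unique-resp-↭ (↭-sym (endpoints-swap M)) ends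
    ; |M|    = trans (length-map swap M) |M|
    ; |N|    = trans (length-map swap N) |N|
    }
    where
    open Decomposition dec
    from : ∀ {u v} → ∃ (λ e → e ∈ M ++ N × (u , v) ≡ swap e) → D v u ≡ true
    from (_ , e∈ , refl) = arcs⁻ e∈
    endpoints-swap : ∀ M → endpoints (map swap M) ↭ endpoints M
    endpoints-swap [] = ↭-refl
    endpoints-swap ((u , v) ∷ M) = _↭_.swap v u (endpoints-swap M)

  decompose : ∀ {D M} → IsOrientation n G D → numEdges G ≡ n + 1 → IsMatching G M → length M ≡ m →
              ∃ λ M′ → ∃ λ N → Decomposition D M′ N × arcs D ↭ M′ ++ N
  decompose {D} {M} or |E| (edges , distinct) |M| = M′ , N , dec , p
    where
    M′ : List Arc
    M′ = map (orient D) M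
    ends′ : Unique (endpoints M′)
    ends′ = Unique-resp-↭ (↭-sym (endpoints-orient D M)) distinct
    M′⊆ : ∀ {e} → e ∈ M′ → e ∈ arcs D
    M′⊆ e∈ with (u , v) , uv∈ , refl ← ∈-map⁻ (orient D) e∈ = orient-∈ or (All.lookup edges uv∈)
    complement : ∃ λ N → arcs D ↭ M′ ++ N
    complement = Unique-⊆-complement (Uniqueₚ.map⁻ (Separated.tails (endpoints-separated ends′))) M′⊆
    N : List Arc
    N = proj₁ complement
    p : arcs D ↭ M′ ++ N
    p = proj₂ complement
    |M′| : length M′ ≡ m
    |M′| = trans (length-map (orient D) M) |M|
    dec : Decomposition D M′ N
    dec = record
      { arcs⁺  = λ d → ∈-resp-↭ p (∈-arcs⁺ D d)
      ; arcs⁻  = λ uv∈ → ∈-arcs⁻ D (∈-resp-↭ (↭-sym p) uv∈)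
      ; unique = Unique-resp-↭ p (arcs-unique D)
      ; ends   = ends′
      ; |M|    = |M′|
      ; |N|    = +-cancelˡ-≡ m _ _ (begin
          m + length N            ≡⟨ cong (_+ length N) (sym |M′|) ⟩
          length M′ + length N    ≡⟨ sym (length-++ M′) ⟩
          length (M′ ++ N)        ≡⟨ sym (↭-length p) ⟩
          length (arcs D)         ≡⟨ length-arcs or ⟩
          numEdges G              ≡⟨ |E| ⟩
          n + 1                   ≡⟨ cong (_+ 1) n≡ ⟩
          5 + (r + 1) + 2 * l + 1 ≡⟨ alg r l ⟩
          m + (4 + r + l) ∎)
      }
      where
      open ≡-Reasoning
      alg : ∀ r l → 5 + (r + 1) + 2 * l + 1 ≡ 3 + l + (4 + r + l)
      alg = solve-∀

  -- The arc from the centre to its mate joins the star, so the out-neighbours of the centre are the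
  -- mate and the heads of `N`. The spokes are left to be sorted into triangle edges and outer path
  -- edges.
  hub⇒≅B1 : ∀ {D M N} → IsOrientation n G D → Decomposition D M N → Hub M N → D ≅ B1 n m
  hub⇒≅B1 {D} {M} {N} or dec h = ToModel.≅B1 {n} {m} {l} n≡ D {a} {Y} {R} arc⁻ arc-Y (λ e∈ → arcs⁻ (∈-++⁺ˡ (R⊆M e∈))) uY uR
      (λ e∈ → there (attached e∈)) spanning
      (cong suc (trans (length-map proj₂ N) |N|)) (suc-injective (trans (sym (↭-length M↭)) |M|))
    where
    open Decomposition dec
    open IsOrientation or
    open Hub h renaming (centre to a; mate to y; spokes to R)
    Y : List (Fin n)
    Y = y ∷ map proj₂ N
    R⊆M : ∀ {e} → e ∈ R → e ∈ M
    R⊆M e∈ = ∈-resp-↭ (↭-sym M↭) (there e∈)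
    ay∈M : (a , y) ∈ M
    ay∈M = ∈-resp-↭ (↭-sym M↭) (here refl)
    arc⁻ : ∀ {u v} → D u v ≡ true → (u ≡ a × v ∈ Y) ⊎ ((u , v) ∈ R)
    arc⁻ d with ∈-++⁻ M (arcs⁺ d)
    ... | inj₂ e∈N = inj₁ (star e∈N , there (∈-map⁺ proj₂ e∈N))
    ... | inj₁ e∈M with ∈-resp-↭ M↭ e∈M
    ... | here refl = inj₁ (refl , here refl)
    ... | there e∈R = inj₂ e∈R
    arc-Y : ∀ {v} → v ∈ Y → D a v ≡ true
    arc-Y (here refl) = arcs⁻ (∈-++⁺ˡ ay∈M)
    arc-Y (there v∈) with e , e∈ , refl ← ∈-map⁻ proj₂ v∈ =
      subst (λ z → D z (proj₂ e) ≡ true) (star e∈) (arcs⁻ (∈-++⁺ʳ M e∈))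
    no-loop : ∀ u → D u u ≢ true
    no-loop u d with () ← trans (sym d) (asym u u d)
    uY : Unique (a ∷ Y)
    uY = Unique-∷ (λ a∈ → no-loop a (arc-Y a∈))
           (Unique-∷ (star-fresh (Unique-++⁻-disjoint M unique ay∈M) star) (star-heads-unique (Unique-++⁻ʳ M unique) star))
    uR : Unique (a ∷ endpoints R)
    uR = Unique-++⁻ʳ (y ∷ []) (Unique-resp-↭ (↭-trans (endpoints-↭ M↭) (_↭_.swap a y ↭-refl)) ends)
    -- By connectedness a vertex other than `a` has a walk to `a` with a first edge, so it is an end
    -- of some arc.
    spanning : ∀ z → (z ≡ a) ⊎ (z ∈ Y) ⊎ (z ∈ endpoints R)
    spanning z = from-walk (connected z a)
      where
      incident : ∀ {w} → (D z w ≡ true) ⊎ (D w z ≡ true) → (z ≡ a) ⊎ (z ∈ Y) ⊎ (z ∈ endpoints R)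
      incident (inj₁ d) with arc⁻ d
      ... | inj₁ (z≡a , _) = inj₁ z≡a
      ... | inj₂ e∈        = inj₂ (inj₂ (tail∈endpoints e∈))
      incident (inj₂ d) with arc⁻ d
      ... | inj₁ (_ , z∈)  = inj₂ (inj₁ z∈)
      ... | inj₂ e∈        = inj₂ (inj₂ (head∈endpoints e∈))
      ∨-true : ∀ {b c} → b ∨ c ≡ true → (b ≡ true) ⊎ (c ≡ true)
      ∨-true {true}  _ = inj₁ refl
      ∨-true {false} h = inj₂ h
      from-walk : Walk G z a → (z ≡ a) ⊎ (z ∈ Y) ⊎ (z ∈ endpoints R)
      from-walk here = inj₁ refl
      from-walk (step {w = w} g _) = incident (∨-true (trans (sym (cover z w)) g))

  module _ {D M} (or : IsOrientation n G D)
           (|E| : numEdges G ≡ n + 1) (matching : IsMatching G M) (|M| : length M ≡ m) where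

    -- Here `2 + l` is m - 1, and `4 + r + l` is n + 1 - m, the number of arcs outside the matching.
    twiceM1≤ : twiceM1 D ≤ bound (2 + l) (4 + r + l)
    twiceM1≤ with M′ , N , dec , p ← decompose or |E| matching |M| = begin
      twiceM1 D               ≡⟨ twiceM1≡energy D ⟩
      energy (arcs D)         ≡⟨ energy-↭ p ⟩
      energy (M′ ++ N)
        ≤⟨ energy≤bound {M = M′} (Decomposition.|M| dec) (endpoints-separated (Decomposition.ends dec))
             (4 + r + l) (Decomposition.|N| dec) (Decomposition.unique dec) ⟩
      bound (2 + l) (4 + r + l) ∎
      where open ≤-Reasoning

    tight⇒≅ : twiceM1 D ≡ bound (2 + l) (4 + r + l) → (D ≅ B1 n m) ⊎ (D ≅ B2 n m)
    tight⇒≅ eq = classify (tight⇒hub {M = M′} {N = N} (Decomposition.|M| dec)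
        (endpoints-separated (Decomposition.ends dec)) (Decomposition.unique dec)
        (m≤m+n 2 l) (≤-trans (+-monoˡ-≤ l (m≤m+n 4 r)) (≤-reflexive (sym (Decomposition.|N| dec)))) tight)
      where
      split-arcs = decompose or |E| matching |M|
      M′ N : List Arc
      M′ = proj₁ split-arcs
      N = proj₁ (proj₂ split-arcs)
      dec : Decomposition D M′ N
      dec = proj₁ (proj₂ (proj₂ split-arcs))
      tight : energy (M′ ++ N) ≡ bound (2 + l) (length N)
      tight = trans (sym (energy-↭ (proj₂ (proj₂ (proj₂ split-arcs)))))
                (trans (sym (twiceM1≡energy D)) (trans eq (cong (bound (2 + l)) (sym (Decomposition.|N| dec)))))
      classify : Hub M′ N ⊎ Hub (map swap M′) (map swap N) → (D ≅ B1 n m) ⊎ (D ≅ B2 n m)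
      classify (inj₁ h) = inj₁ (hub⇒≅B1 or dec h)
      classify (inj₂ h) = inj₂ (reverse-≅B1 {m = m} (hub⇒≅B1 (reverse-orientation or) (reverse-decomposition dec) h))

    -- The lower bound for the model has the same value as the general upper bound.
    ≅B1⇒tight : D ≅ B1 n m → twiceM1 D ≡ bound (2 + l) (4 + r + l)
    ≅B1⇒tight iso = ≤-antisym twiceM1≤ (begin
      bound (2 + l) (4 + r + l)                                             ≡⟨ alg r l ⟩
      (4 + (r + 1) + l) * suc (4 + (r + 1) + l) + 4 * (2 + l)               ≤⟨ FromModel.≅B1⇒energy≥ n m l n≡ iso ⟩
      energy (arcs D)                                                       ≡⟨ sym (twiceM1≡energy D) ⟩
      twiceM1 D ∎)
      where
      open ≤-Reasoning
      alg : ∀ r l → (4 + r + l) * (4 + r + l) + 3 * (4 + r + l) + 4 * (2 + l) + 2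
                    ≡ (4 + (r + 1) + l) * suc (4 + (r + 1) + l) + 4 * (2 + l)
      alg = solve-∀

bound-value : ∀ {n} l r → n ≡ 5 + (r + 1) + 2 * l → let m = 3 + l; k = 4 + r + l in
              (k * k + 3 * k + 4 * (2 + l) + 2) + m * (1 + 2 * n) ≡ m * m + n * n + 5 * n + 2
bound-value l r refl = alg l r
  where
  alg : ∀ l r → (4 + r + l) * (4 + r + l) + 3 * (4 + r + l) + 4 * (2 + l) + 2 + (3 + l) * (1 + 2 * (5 + (r + 1) + 2 * l))
        ≡ (3 + l) * (3 + l) + (5 + (r + 1) + 2 * l) * (5 + (r + 1) + 2 * l) + 5 * (5 + (r + 1) + 2 * l) + 2
  alg = solve-∀

theorem2 : (n m : ℕ) → 3 ≤ m → m ≤ n / 2 →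
    (G D : Rel n) → SimpleGraph n G → Bicyclic n G → MatchingNumber G m →
    IsOrientation n G D →
    (twiceM1 D + m * (1 + 2 * n) ≤ m * m + n * n + 5 * n + 2)
    × ((twiceM1 D + m * (1 + 2 * n) ≡ m * m + n * n + 5 * n + 2)
    ⇔ (D ≅ B1 n m ⊎ D ≅ B2 n m))
theorem2 n m 3≤m m≤n/2 G D _ (connected , |E|) ((M , matching , |M|) , _) or with l , refl ← m≤n⇒∃[o]m+o≡n 3≤m =
    subst (twiceM1 D + c ≤_) value (+-monoˡ-≤ c (twiceM1≤ or |E| matching |M|))
  , mk⇔ (λ eq → tight⇒≅ or |E| matching |M| (+-cancelʳ-≡ c _ _ (trans eq (sym value))))
        (λ iso → trans (cong (_+ c) (tight iso)) value)
  where
  n≡ : n ≡ 5 + ((n ∸ 2 * (3 + l)) + 1) + 2 * l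
  n≡ = half-range m≤n/2
  open Bicyclics n≡ connected
  -- The negative part of the bound, moved to the other side to stay within the natural numbers.
  c : ℕ
  c = (3 + l) * (1 + 2 * n)
  value = bound-value l (n ∸ 2 * (3 + l)) n≡
  tight : (D ≅ B1 n (3 + l)) ⊎ (D ≅ B2 n (3 + l)) → twiceM1 D ≡ _
  tight (inj₁ iso) = ≅B1⇒tight or |E| matching |M| iso
  -- Reversal exchanges in-degrees and out-degrees, which preserves the index and reduces this case
  -- to the first model.
  tight (inj₂ iso) = trans (sym (twiceM1-reverse D))
    (≅B1⇒tight (reverse-orientation or) |E| matching |M| (≅B2⇒reverse-≅B1 {m = 3 + l} {D = D} iso))
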